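{- Let $q$ be an odd prime power, $p=\operatorname{char}\mathbb F_q$, $Q(x)=x_1^2+\cdots+x_d^2$ on $\mathbb F_q^d$, and $d\ge2$ with $p\mid d+2$. Suppose that $P_0,\ldots,P_{d+1}\in\mathbb F_q^d$ are equilateral with nonzero common squared distance $\Delta$, i.e. $Q(P_i-P_j)=\Delta\in\mathbb F_q^*$ for all $i\neq j$, and put $$X=\left\{\frac{P_i+P_j}{2}:0\le i<j\le d+1\right\}.$$ Then $X$ is a two-distance set of size $\binom{d+2}{2}$, with squared distances $\Delta/4$ and $\Delta/2$. If $H_X$ is the affine coordinate matrix of $X$ and $\widehat H_X$ is obtained from $H_X$ by adjoining the row $(Q(x))_{x\in X}$, then $$\operatorname{rank}\widehat H_X-\operatorname{rank}(H_X\widehat H_X^T)=1.$$ Consequently, the general bound $|S|\le\binom{d+2}{2}-1+\operatorname{rank}\widehat H_S-\operatorname{rank}(H_S\widehat H_S^T)$, valid for two-distance sets $S\subset\mathbb F_q^d$ with two distinct nonzero squared distances, gives for $S=X$ the sharp bound $|X|\le\binom{d+2}{2}$.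
   Context: A set $S\subseteq\mathbb F_q^d$ is a two-distance set if $Q(x-y)$, over distinct $x,y\in S$, takes exactly two values, called its squared distances. For a finite set $S\subset\mathbb F_q^d$, the affine coordinate matrix $H_S$ is the $(d+1)\times|S|$ matrix over $\mathbb F_q$ whose columns are indexed by the points of $S$, the column of $x$ being $(1,x_1,\ldots,x_d)^T$; $\widehat H_S$ is the $(d+2)\times|S|$ matrix obtained by adjoining the row $(Q(x))_{x\in S}$. Ranks are over $\mathbb F_q$. -}

module Defs where

open import Algebra.Bundles using (CommutativeRing)
import Algebra.Definitions as AlgDef
import Algebra.Properties.Semiring.Mult as Mult
import Algebra.Properties.Semiring.Sum as Sum
open import Data.Fin.Base as Fin using (Fin; finToFun; funToFin)
import Data.Fin.Properties as Fin
open import Data.Integer.Base as ℤ using (ℤ; +_; 1ℤ)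
open import Data.List.Base
  using (List; length; lookup; map; filter; allFin; cartesianProduct; deduplicate)
import Data.List.Membership.Setoid as Membership
import Data.List.Relation.Unary.Unique.Setoid as Unique
open import Data.List.Relation.Unary.Unique.DecSetoid.Properties using (deduplicate-!)
open import Data.Nat.Base as ℕ using (ℕ; zero; suc)
open import Data.Nat.Combinatorics using (_C_)
open import Data.Nat.Primality using (Prime)
open import Data.Product.Base using (∃; ∃₂; _×_; _,_; proj₁; uncurry)
open import Data.Sum.Base using (_⊎_)
open import Data.Vec.Functional using (Vector; _∷_)
import Data.Vec.Functional.Relation.Binary.Equality.Setoid as VecEq
import Data.Vec.Functional.Relation.Binary.Pointwise.Properties as Pointwise
open import Function.Base using (_∘_)
open import Function.Bundles using (Inverse; _⇔_)
open import Function.Properties.Inverse using (Inverse⇒Injection)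
open import Level using (Level; _⊔_) renaming (suc to lsuc)
open import Relation.Binary.Bundles using (DecSetoid)
open import Relation.Binary.Definitions using (Decidable)
open import Relation.Binary.PropositionalEquality as ≡ using (_≡_; _≢_; _≗_)
open import Relation.Nullary.Decidable
  using (Dec; yes; no; map′; _→-dec_; via-injection)
open import Relation.Nullary.Negation using (¬_)
import Relation.Unary as U

private
  variable
    a : Level
    k m n : ℕ

IsPrimePower : ℕ → Set
IsPrimePower q = ∃₂ λ p e → Prime p × 1 ℕ.≤ e × q ≡ p ℕ.^ e

-- The largest k ≤ m with P k, and 0 if there is none.
largest : {P : ℕ → Set a} → U.Decidable P → ℕ → ℕ
largest P? zero = zero
largest P? (suc m) with P? (suc m)
... | yes _ = suc m
... | no  _ = largest P? m

module _ {P : (Fin k → Fin m) → Set a}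
         (resp : ∀ {f g} → f ≗ g → P f → P g) (P? : U.Decidable P) where

  anyFun? : Dec (∃ P)
  anyFun? = map′ (λ (i , p) → finToFun i , p)
                 (λ (f , p) → funToFin f , resp (≡.sym ∘ Fin.finToFun-funToFin f) p)
                 (Fin.any? (P? ∘ finToFun))

  allFun? : Dec (∀ f → P f)
  allFun? = map′ (λ h f → resp (Fin.finToFun-funToFin f) (h (funToFin f)))
                 (λ h i → h (finToFun i))
                 (Fin.all? (P? ∘ finToFun))

record FiniteField (c ℓ : Level) (q : ℕ) : Set (lsuc (c ⊔ ℓ)) where
  field
    commutativeRing : CommutativeRing c ℓ

  open CommutativeRing commutativeRing public
  open AlgDef _≈_ using (LeftInvertible)

  field
    0≉1      : ¬ 0# ≈ 1#
    inverse  : ∀ x → ¬ x ≈ 0# → LeftInvertible 1# _*_ x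
    finite   : Inverse setoid (≡.setoid (Fin q))

  infix 4 _≟_
  _≟_ : Decidable _≈_
  _≟_ = via-injection (Inverse⇒Injection finite) Fin._≟_

  infix  8 _⁻¹
  infixl 7 _/_

  -- Convention: 0# ⁻¹ = 0#.
  _⁻¹ : Carrier → Carrier
  x ⁻¹ with x ≟ 0#
  ... | yes _   = 0#
  ... | no  x≉0 = proj₁ (inverse x x≉0)

  _/_ : Carrier → Carrier → Carrier
  x / y = x * y ⁻¹

  fromℕ : ℕ → Carrier
  fromℕ n = n ·ℕ 1#
    where open Mult semiring using () renaming (_×_ to _·ℕ_)

  IsCharacteristic : ℕ → Set ℓ
  IsCharacteristic p =
    0 ℕ.< p × fromℕ p ≈ 0# × (∀ n → 0 ℕ.< n → n ℕ.< p → ¬ fromℕ n ≈ 0#)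

module LinearAlgebra {c ℓ q} (F : FiniteField c ℓ q) where
  open FiniteField F
  open Sum semiring using (sum-syntax; sum-cong-≋)

  Matrix : ℕ → ℕ → Set c
  Matrix m n = Vector (Vector Carrier n) m

  infixl 7 _⊡_
  _⊡_ : Matrix m k → Matrix k n → Matrix m n
  _⊡_ {k = k} A B i j = ∑[ l < k ] (A i l * B l j)

  infix 8 _ᵀ
  _ᵀ : Matrix m n → Matrix n m
  (A ᵀ) i j = A j i

  LinearlyIndependent : Vector (Vector Carrier n) k → Set (c ⊔ ℓ)
  LinearlyIndependent {k = k} v =
    ∀ (α : Vector Carrier k) →
    (∀ j → ∑[ i < k ] (α i * v i j) ≈ 0#) → ∀ i → α i ≈ 0#

  linearlyIndependent? : U.Decidable (LinearlyIndependent {n} {k})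
  linearlyIndependent? {n} {k} v =
    map′ (λ h α rel i → trans (sym (dec α i))
            (h (to ∘ α) (λ j → trans (cong j (dec α)) (rel j)) i))
         (λ h f → h (from ∘ f))
         (allFun? (λ f≗g h rel i → trans (reflexive (≡.cong from (≡.sym (f≗g i))))
                     (h (λ j → trans (cong j (reflexive ∘ ≡.cong from ∘ f≗g)) (rel j)) i))
                  (λ f → Fin.all? (λ j → _ ≟ _) →-dec Fin.all? (λ i → _ ≟ _)))
    where
    open Inverse finite using (to; from; strictlyInverseʳ)
    dec : ∀ (α : Vector Carrier k) i → from (to (α i)) ≈ α i
    dec α i = strictlyInverseʳ (α i)
    cong : ∀ {α β : Vector Carrier k} j → (∀ i → α i ≈ β i) →
           ∑[ i < k ] (α i * v i j) ≈ ∑[ i < k ] (β i * v i j)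
    cong j e = sum-cong-≋ (λ i → *-congʳ (e i))

  HasIndependentRows : Matrix m n → ℕ → Set (c ⊔ ℓ)
  HasIndependentRows {m} M k = ∃ λ (ρ : Fin k → Fin m) → LinearlyIndependent (M ∘ ρ)

  hasIndependentRows? : (M : Matrix m n) → U.Decidable (HasIndependentRows M)
  hasIndependentRows? M k =
    anyFun? (λ f≗g li α rel → li α (λ j → trans
               (sum-cong-≋ (λ i → *-congˡ (reflexive (≡.cong (λ r → M r j) (f≗g i)))))
               (rel j)))
            (λ ρ → linearlyIndependent? (M ∘ ρ))

  -- The maximal number of linearly independent rows (independence of M ∘ ρ
  -- forces ρ to be injective, so k ≤ m is no restriction).
  rank : Matrix m n → ℕ
  rank {m} M = largest (hasIndependentRows? M) m

module Geometry {c ℓ q} (F : FiniteField c ℓ q) where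
  open FiniteField F
  open LinearAlgebra F
  open Sum semiring using (sum-syntax)

  Point : ℕ → Set c
  Point d = Vector Carrier d

  pointDecSetoid : ℕ → DecSetoid c ℓ
  pointDecSetoid d = Pointwise.decSetoid decSetoid d
    where
    decSetoid : DecSetoid c ℓ
    decSetoid = record { isDecEquivalence = record { isEquivalence = isEquivalence ; _≟_ = _≟_ } }

  module _ {d : ℕ} where
    open DecSetoid (pointDecSetoid d) public
      using () renaming (_≈_ to _≋_; _≟_ to _≋?_)

    infixl 6 _−_
    _−_ : Point d → Point d → Point d
    (x − y) i = x i - y i

    Q : Point d → Carrier
    Q x = ∑[ i < d ] (x i * x i)

    midpoint : Point d → Point d → Point d
    midpoint x y i = (x i + y i) / fromℕ 2

  record FiniteSet (d : ℕ) : Set (c ⊔ ℓ) where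
    field
      points : List (Point d)
      unique : Unique.Unique (DecSetoid.setoid (pointDecSetoid d)) points

    open Membership (DecSetoid.setoid (pointDecSetoid d)) using () renaming (_∈_ to _∈ˡ_)

    infix 4 _∈S
    _∈S : Point d → Set (c ⊔ ℓ)
    x ∈S = x ∈ˡ points

  module _ {d : ℕ} where

    ∣_∣ : FiniteSet d → ℕ
    ∣ S ∣ = length (FiniteSet.points S)

    fromList : List (Point d) → FiniteSet d
    fromList xs = record
      { points = deduplicate _≋?_ xs
      ; unique = deduplicate-! (pointDecSetoid d) xs
      }

    IsSquaredDistance : FiniteSet d → Carrier → Set (c ⊔ ℓ)
    IsSquaredDistance S t =
      ∃₂ λ x y → x ∈S × y ∈S × ¬ x ≋ y × Q (x − y) ≈ t
      where open FiniteSet S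

    IsTwoDistance : FiniteSet d → Carrier → Carrier → Set (c ⊔ ℓ)
    IsTwoDistance S a b =
      ¬ a ≈ b × (∀ t → IsSquaredDistance S t ⇔ (t ≈ a ⊎ t ≈ b))

    H : (S : FiniteSet d) → Matrix (1 ℕ.+ d) ∣ S ∣
    H S i j = (1# ∷ lookup (FiniteSet.points S) j) i

    -- The row of Q-values is adjoined on top; its position does not affect ranks.
    Ĥ : (S : FiniteSet d) → Matrix (2 ℕ.+ d) ∣ S ∣
    Ĥ S = (λ j → Q (lookup (FiniteSet.points S) j)) ∷ H S

    bound : FiniteSet d → ℤ
    bound S = + ((2 ℕ.+ d) C 2) ℤ.- 1ℤ ℤ.+ + rank (Ĥ S) ℤ.- + rank (H S ⊡ Ĥ S ᵀ)

    IsEquilateral : Vector (Point d) n → Carrier → Set ℓ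
    IsEquilateral P Δ = ∀ i j → i ≢ j → Q (P i − P j) ≈ Δ

    midpointSet : Vector (Point d) n → FiniteSet d
    midpointSet {n} P =
      fromList (map (uncurry λ i j → midpoint (P i) (P j))
                    (filter (uncurry Fin._<?_) (cartesianProduct (allFin n) (allFin n))))

  GeneralBound : ℕ → Set (c ⊔ ℓ)
  GeneralBound d =
    ∀ (S : FiniteSet d) a b → IsTwoDistance S a b → ¬ a ≈ 0# → ¬ b ≈ 0# →
    + ∣ S ∣ ℤ.≤ bound S

{-# OPTIONS --safe #-}
module Submission where

-- The matrix A with columns halfColumn (P i) is square, and the column of Ĥ at the midpoint of
-- P i and P k is the sum of columns i and k of A.  A linear relation between the rows of Ĥ Ĥᵀ
-- is a vector g in the row space of A such that (g i + g k) over i < k is orthogonal to every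
-- row (a i + a k) of Ĥ.  As d + 2 = 0 in F, this inner product is (∑ g)(∑ a) − 2 ∑ g a; the
-- constant row forces ∑ g = 0, so g is orthogonal to every row of A.  Pairing g with
-- k ↦ ½ Q(P j − P k), a combination of these rows, gives ½ Δ g j = 0, so g = 0.  The same
-- computation shows that the columns, hence over a finite field the rows, of A are independent.
-- So Ĥ Ĥᵀ is nonsingular, and Ĥ and H Ĥᵀ have full row rank.

open import Defs
open import Algebra.Bundles using (CommutativeMonoid; CommutativeRing; RawRing)
import Algebra.Properties.AbelianGroup as AbelianGroupProperties
import Algebra.Properties.CommutativeMonoid.Sum as MonoidSum
import Algebra.Properties.Ring as RingProperties
import Algebra.Properties.Semiring.Mult as Mult
import Algebra.Properties.Semiring.Sum as Sum
import Algebra.Solver.Ring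
open import Algebra.Solver.Ring.AlmostCommutativeRing
  using (AlmostCommutativeRing; fromCommutativeRing; -raw-almostCommutative⟶; _-Raw-AlmostCommutative⟶_)
open import Data.Bool.Base using (true; false; if_then_else_)
open import Data.Fin.Base as Fin using (Fin; zero; suc; finToFun; funToFin; punchOut)
open import Data.Fin.Permutation using (permutation)
import Data.Fin.Properties as Fin
open import Data.Integer.Base as ℤ using (+_; 1ℤ)
import Data.Integer.Properties as ℤ
open import Data.List.Base
  using (List; []; _∷_; _++_; length; lookup; map; filter; allFin; tabulate;
         cartesianProduct; deduplicate)
open import Data.List.Membership.Propositional using (_∈_)
open import Data.List.Membership.Propositional.Properties
  using (∈-allFin; ∈-cartesianProduct⁺; ∈-filter⁺)
open import Data.List.Properties using (filter-all; length-map)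
open import Data.List.Relation.Unary.All as All using (All; []; _∷_)
open import Data.List.Relation.Unary.All.Properties as All using (all-filter)
open import Data.List.Relation.Unary.AllPairs using (AllPairs; []; _∷_)
open import Data.List.Relation.Unary.Any as Any using (Any)
open import Data.List.Relation.Unary.Any.Properties as Any using ()
open import Data.List.Relation.Unary.Unique.Propositional using (Unique)
open import Data.List.Relation.Unary.Unique.Propositional.Properties as Unique using ()
open import Data.Maybe.Base using (Maybe; just; nothing)
open import Data.Nat.Base as ℕ using (ℕ; zero; suc)
import Data.Nat.Properties as ℕ
open import Data.Nat.Solver using (module +-*-Solver)
open import Data.Nat.Combinatorics using (_C_; nC1≡n; nCk+nC[k+1]≡[n+1]C[k+1])
open import Data.Nat.DivMod as ℕ using ()
open import Data.Nat.Divisibility using (_∣_; divides; m%n≡0⇒n∣m)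
open import Data.Product.Base using (∃; _×_; _,_; proj₁; proj₂; uncurry)
open import Data.Sum.Base using (_⊎_; inj₁; inj₂)
open import Data.Vec.Functional as VF using (Vector)
open import Function.Base using (_∘_; id)
open import Function.Bundles using (Inverse; mk⇔)
open import Function.Definitions using (Injective)
open import Relation.Binary.Bundles using (DecSetoid)
open import Relation.Binary.Definitions using (tri<; tri≈; tri>)
open import Relation.Binary.PropositionalEquality as ≡ using (_≡_; _≢_)
import Relation.Binary.Reasoning.Setoid as SetoidReasoning
open import Relation.Nullary.Decidable using (yes; no; does; dec-true; dec-false; ¬?)
open import Relation.Nullary.Negation using (¬_; contradiction)
import Relation.Unary as U

-- Pigeonhole principle and duplicate-free lists.

-- A missed value `y` could be punched out of the codomain, leaving an injection from `Fin (suc m)`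
-- into `Fin m`.
injective⇒surjective : ∀ {m} {f : Fin m → Fin m} → Injective _≡_ _≡_ f → ∀ y → ∃ λ x → f x ≡ y
injective⇒surjective {suc m} {f} inj y with Fin.any? (λ x → f x Fin.≟ y)
... | yes hit = hit
... | no ¬hit = contradiction (Fin.injective⇒≤ g-injective) ℕ.1+n≰n
  where
  y≢f : ∀ x → y ≢ f x
  y≢f x y≡fx = ¬hit (x , ≡.sym y≡fx)
  g : Fin (suc m) → Fin m
  g x = punchOut (y≢f x)
  g-injective : Injective _≡_ _≡_ g
  g-injective {x} {x′} eq = inj (Fin.punchOut-injective (y≢f x) (y≢f x′) eq)

module _ {a ℓ} (S : DecSetoid a ℓ) where
  open DecSetoid S

  -- `fromList` deduplicates. Once the midpoints are known to be distinct, this exposes the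
  -- underlying list, over which cardinality and sums can be computed.
  deduplicate-unique : ∀ {xs} → AllPairs (λ x y → ¬ x ≈ y) xs → deduplicate _≟_ xs ≡ xs
  deduplicate-unique []                     = ≡.refl
  deduplicate-unique {x ∷ xs} (x≉xs ∷ xs!) =
    ≡.cong (x ∷_) (≡.trans (≡.cong (filter (¬? ∘ (x ≟_))) (deduplicate-unique xs!))
                           (filter-all (¬? ∘ (x ≟_)) x≉xs))

-- Sums over lists.

module ListSum {c ℓ} (M : CommutativeMonoid c ℓ) where
  open CommutativeMonoid M
    renaming ( _∙_ to infixl 6 _+_; ε to 0#; ∙-cong to +-cong; ∙-congˡ to +-congˡ
             ; identityˡ to +-identityˡ; assoc to +-assoc)
  open MonoidSum M using (sum-syntax)

  -- Indexed by positions rather than folded, so that for the points of a finite set it is literally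
  -- the sum over columns occurring in a matrix product.
  ∑ₗ : ∀ {a} {A : Set a} → List A → (A → Carrier) → Carrier
  ∑ₗ xs f = ∑[ l < length xs ] f (lookup xs l)

  ∑ₗ-cong-All : ∀ {a} {A : Set a} {xs : List A} {f g : A → Carrier} →
                All (λ x → f x ≈ g x) xs → ∑ₗ xs f ≈ ∑ₗ xs g
  ∑ₗ-cong-All []       = refl
  ∑ₗ-cong-All (e ∷ es) = +-cong e (∑ₗ-cong-All es)

  ∑ₗ-++ : ∀ {a} {A : Set a} (xs ys : List A) (f : A → Carrier) →
          ∑ₗ (xs ++ ys) f ≈ ∑ₗ xs f + ∑ₗ ys f
  ∑ₗ-++ []       ys f = sym (+-identityˡ _)
  ∑ₗ-++ (x ∷ xs) ys f = trans (+-congˡ (∑ₗ-++ xs ys f)) (sym (+-assoc _ _ _))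

  ∑ₗ-map : ∀ {a b} {A : Set a} {B : Set b} (g : B → A) (xs : List B) (f : A → Carrier) →
           ∑ₗ (map g xs) f ≡ ∑ₗ xs (f ∘ g)
  ∑ₗ-map g []       f = ≡.refl
  ∑ₗ-map g (x ∷ xs) f = ≡.cong₂ _+_ ≡.refl (∑ₗ-map g xs f)

  ∑ₗ-tabulate : ∀ {a} {A : Set a} {n} (g : Fin n → A) (f : A → Carrier) →
                ∑ₗ (tabulate g) f ≡ ∑[ i < n ] f (g i)
  ∑ₗ-tabulate {n = zero}  g f = ≡.refl
  ∑ₗ-tabulate {n = suc n} g f = ≡.cong₂ _+_ ≡.refl (∑ₗ-tabulate (g ∘ suc) f)

  ∑ₗ-cartesianProduct : ∀ {a b} {A : Set a} {B : Set b} (xs : List A) (ys : List B)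
                        (f : A × B → Carrier) →
                        ∑ₗ (cartesianProduct xs ys) f ≈ ∑ₗ xs (λ x → ∑ₗ ys (λ y → f (x , y)))
  ∑ₗ-cartesianProduct []       ys f = refl
  ∑ₗ-cartesianProduct (x ∷ xs) ys f =
    trans (∑ₗ-++ (map (x ,_) ys) (cartesianProduct xs ys) f)
          (+-cong (reflexive (∑ₗ-map (x ,_) ys f)) (∑ₗ-cartesianProduct xs ys f))

  ∑ₗ-filter : ∀ {a p} {A : Set a} {P : A → Set p} (P? : U.Decidable P) (xs : List A)
              (f : A → Carrier) →
              ∑ₗ (filter P? xs) f ≈ ∑ₗ xs (λ x → if does (P? x) then f x else 0#)
  ∑ₗ-filter P? []       f = refl
  ∑ₗ-filter P? (x ∷ xs) f with does (P? x)
  ... | true  = +-congˡ (∑ₗ-filter P? xs f)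
  ... | false = trans (∑ₗ-filter P? xs f) (sym (+-identityˡ _))

-- Pairs of indices i < j: sums over them and their number.

-- The same list expression as inside `midpointSet`, so the two agree by computation.
orderedPairs : ∀ n → List (Fin n × Fin n)
orderedPairs n = filter (uncurry Fin._<?_) (cartesianProduct (allFin n) (allFin n))

orderedPairs-< : ∀ n → All (uncurry Fin._<_) (orderedPairs n)
orderedPairs-< n = all-filter (uncurry Fin._<?_) (cartesianProduct (allFin n) (allFin n))

∈-orderedPairs : ∀ {n} {i j : Fin n} → i Fin.< j → (i , j) ∈ orderedPairs n
∈-orderedPairs {i = i} {j} = ∈-filter⁺ (uncurry Fin._<?_) (∈-cartesianProduct⁺ (∈-allFin i) (∈-allFin j))

orderedPairs-unique : ∀ n → Unique (orderedPairs n)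
orderedPairs-unique n =
  Unique.filter⁺ (uncurry Fin._<?_) (Unique.cartesianProduct⁺ (Unique.allFin⁺ n) (Unique.allFin⁺ n))

module PairSum {c ℓ} (M : CommutativeMonoid c ℓ) where
  open CommutativeMonoid M
    renaming ( _∙_ to infixl 6 _+_; ε to 0#; ∙-cong to +-cong; ∙-congˡ to +-congˡ
             ; ∙-congʳ to +-congʳ; identityˡ to +-identityˡ; identityʳ to +-identityʳ)
  open MonoidSum M using (sum-syntax; sum-cong-≋; ∑-distrib-+; ∑-comm; sum-replicate-zero)
  open ListSum M
  open SetoidReasoning setoid

  sum-pointMass : ∀ {n} (i : Fin n) (f : Fin n → Carrier) →
                  ∑[ j < n ] (if does (i Fin.≟ j) then f j else 0#) ≈ f i
  sum-pointMass {suc n} zero    f = trans (+-congˡ (sum-replicate-zero n)) (+-identityʳ _)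
  sum-pointMass {suc n} (suc i) f = trans (+-identityˡ _) (sum-pointMass i (f ∘ suc))

  module _ {n} (F : Fin n → Fin n → Carrier) (F-sym : ∀ i j → F i j ≈ F j i) where
    private
      upper diag : Fin n → Fin n → Carrier
      upper i j = if does (i Fin.<? j) then F i j else 0#
      diag  i j = if does (i Fin.≟ j)  then F i j else 0#

      trichotomy : ∀ i j → (upper i j + upper j i) + diag i j ≈ F i j
      trichotomy i j with Fin.<-cmp i j
      ... | tri< i<j i≢j j≮i
        rewrite dec-true (i Fin.<? j) i<j | dec-false (j Fin.<? i) j≮i | dec-false (i Fin.≟ j) i≢j =
        trans (+-identityʳ _) (+-identityʳ _)
      ... | tri≈ i≮j i≡j j≮i
        rewrite dec-false (i Fin.<? j) i≮j | dec-false (j Fin.<? i) j≮i | dec-true (i Fin.≟ j) i≡j =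
        trans (+-congʳ (+-identityʳ _)) (+-identityˡ _)
      ... | tri> i≮j i≢j j<i
        rewrite dec-false (i Fin.<? j) i≮j | dec-true (j Fin.<? i) j<i | dec-false (i Fin.≟ j) i≢j =
        trans (+-identityʳ _) (trans (+-identityˡ _) (F-sym j i))

      ∑-upper : ∑ₗ (orderedPairs n) (uncurry F) ≈ ∑[ i < n ] ∑[ j < n ] upper i j
      ∑-upper = begin
        ∑ₗ (orderedPairs n) (uncurry F)
          ≈⟨ ∑ₗ-filter (uncurry Fin._<?_) (cartesianProduct (allFin n) (allFin n)) (uncurry F) ⟩
        ∑ₗ (cartesianProduct (allFin n) (allFin n)) (uncurry upper)
          ≈⟨ ∑ₗ-cartesianProduct (allFin n) (allFin n) (uncurry upper) ⟩
        ∑ₗ (allFin n) (λ i → ∑ₗ (allFin n) (upper i))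
          ≡⟨ ∑ₗ-tabulate id (λ i → ∑ₗ (allFin n) (upper i)) ⟩
        ∑[ i < n ] ∑ₗ (allFin n) (upper i)
          ≈⟨ sum-cong-≋ (λ i → reflexive (∑ₗ-tabulate id (upper i))) ⟩
        ∑[ i < n ] ∑[ j < n ] upper i j ∎

    -- By trichotomy a square array splits into the part above the diagonal, the part below it and
    -- the diagonal, and symmetry makes the first two sums equal. The form avoids halving and
    -- subtraction, so it serves both for counting in ℕ and for sums in the field.
    ∑-orderedPairs : (∑ₗ (orderedPairs n) (uncurry F) + ∑ₗ (orderedPairs n) (uncurry F))
                     + ∑[ i < n ] F i i ≈ ∑[ i < n ] ∑[ j < n ] F i j
    ∑-orderedPairs = begin
      (S + S) + ∑[ i < n ] F i i
        ≈⟨ +-cong (+-cong ∑-upper (trans ∑-upper (∑-comm upper)))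
                  (sum-cong-≋ (λ i → sym (sum-pointMass i (F i)))) ⟩
      (U + ∑[ i < n ] ∑[ j < n ] upper j i) + ∑[ i < n ] ∑[ j < n ] diag i j
        ≈⟨ +-congʳ (sym (∑-distrib-+ {n} _ _)) ⟩
      ∑[ i < n ] (∑[ j < n ] upper i j + ∑[ j < n ] upper j i) + ∑[ i < n ] ∑[ j < n ] diag i j
        ≈⟨ sym (∑-distrib-+ {n} _ _) ⟩
      ∑[ i < n ] (∑[ j < n ] upper i j + ∑[ j < n ] upper j i + ∑[ j < n ] diag i j)
        ≈⟨ sum-cong-≋ (λ i → trans (+-congʳ (sym (∑-distrib-+ (upper i) (λ j → upper j i))))
                                   (sym (∑-distrib-+ {n} _ (diag i)))) ⟩
      ∑[ i < n ] ∑[ j < n ] ((upper i j + upper j i) + diag i j)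
        ≈⟨ sum-cong-≋ (λ i → sum-cong-≋ (trichotomy i)) ⟩
      ∑[ i < n ] ∑[ j < n ] F i j ∎
      where
      S U : Carrier
      S = ∑ₗ (orderedPairs n) (uncurry F)
      U = ∑[ i < n ] ∑[ j < n ] upper i j

-- The formula n(n - 1)/2 without division or subtraction, shaped like `∑-orderedPairs` for the
-- constant array 1.
nC2-double : ∀ n → n C 2 ℕ.+ n C 2 ℕ.+ n ≡ n ℕ.* n
nC2-double zero    = ≡.refl
nC2-double (suc n) = begin
  suc n C 2 ℕ.+ suc n C 2 ℕ.+ suc n
    ≡⟨ ≡.cong (λ k → k ℕ.+ k ℕ.+ suc n) (≡.sym (nCk+nC[k+1]≡[n+1]C[k+1] n 1)) ⟩
  (n C 1 ℕ.+ t) ℕ.+ (n C 1 ℕ.+ t) ℕ.+ suc n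
    ≡⟨ ≡.cong (λ k → (k ℕ.+ t) ℕ.+ (k ℕ.+ t) ℕ.+ suc n) (nC1≡n n) ⟩
  (n ℕ.+ t) ℕ.+ (n ℕ.+ t) ℕ.+ suc n
    ≡⟨ solve 2 (λ x y → (x :+ y) :+ (x :+ y) :+ (con 1 :+ x)
                        := con 1 :+ x :+ x :+ (y :+ y :+ x)) ≡.refl n t ⟩
  suc (n ℕ.+ n ℕ.+ (t ℕ.+ t ℕ.+ n))
    ≡⟨ ≡.cong (λ k → suc (n ℕ.+ n ℕ.+ k)) (nC2-double n) ⟩
  suc (n ℕ.+ n ℕ.+ n ℕ.* n)
    ≡⟨ solve 1 (λ x → con 1 :+ x :+ x :+ x :* x := (con 1 :+ x) :* (con 1 :+ x)) ≡.refl n ⟩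
  suc n ℕ.* suc n ∎
  where
  open ≡.≡-Reasoning
  open +-*-Solver
  t = n C 2

-- For the constant array 1, `∑-orderedPairs` gives the length the same equation that `nC2-double`
-- gives `n C 2`. Cancelling `n` and halving identifies them.
length-orderedPairs : ∀ n → length (orderedPairs n) ≡ n C 2
length-orderedPairs n = begin
  k               ≡⟨ ℕ.n≡⌊n+n/2⌋ k ⟩
  ℕ.⌊ k ℕ.+ k /2⌋ ≡⟨ ≡.cong ℕ.⌊_/2⌋ (ℕ.+-cancelʳ-≡ n (k ℕ.+ k) (b ℕ.+ b)
                                      (≡.trans double (≡.sym (nC2-double n)))) ⟩
  ℕ.⌊ b ℕ.+ b /2⌋ ≡⟨ ≡.sym (ℕ.n≡⌊n+n/2⌋ b) ⟩
  b               ∎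
  where
  open ≡.≡-Reasoning
  open MonoidSum ℕ.+-0-commutativeMonoid using (sum-syntax)
  open PairSum ℕ.+-0-commutativeMonoid
  k b : ℕ
  k = length (orderedPairs n)
  b = n C 2
  ∑1≡ : ∀ m (x : ℕ) → ∑[ _ < m ] x ≡ m ℕ.* x
  ∑1≡ zero    x = ≡.refl
  ∑1≡ (suc m) x = ≡.cong (x ℕ.+_) (∑1≡ m x)
  ∑1≡1 : ∀ m → ∑[ _ < m ] 1 ≡ m
  ∑1≡1 m = ≡.trans (∑1≡ m 1) (ℕ.*-identityʳ m)
  double : k ℕ.+ k ℕ.+ n ≡ n ℕ.* n
  double = begin
    k ℕ.+ k ℕ.+ n
      ≡⟨ ≡.sym (≡.cong₂ (λ x y → x ℕ.+ x ℕ.+ y) (∑1≡1 k) (∑1≡1 n)) ⟩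
    (∑[ _ < k ] 1) ℕ.+ (∑[ _ < k ] 1) ℕ.+ (∑[ _ < n ] 1)
      ≡⟨ ∑-orderedPairs {n} (λ _ _ → 1) (λ _ _ → ≡.refl) ⟩
    ∑[ _ < n ] ∑[ _ < n ] 1
      ≡⟨ ∑1≡ n (∑[ _ < n ] 1) ⟩
    n ℕ.* (∑[ _ < n ] 1)
      ≡⟨ ≡.cong (n ℕ.*_) (∑1≡1 n) ⟩
    n ℕ.* n ∎

-- A ring solver with integer coefficients over any commutative ring.

-- A coefficient (a , b) stands for a − b. The operations return reduced pairs,
-- because the solver compares normal forms syntactically.
module DifferenceSolver {c ℓ} (R : CommutativeRing c ℓ) where
  open CommutativeRing R
  open AbelianGroupProperties +-abelianGroup using (⁻¹-anti-homo‿-)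
  open RingProperties ring using (-‿distribˡ-*; -‿distribʳ-*; -‿involutive; -0#≈0#)
  open Mult semiring using (×-homo-+; ×1-homo-*) renaming (_×_ to _·_)
  open SetoidReasoning setoid

  private
    -- Coefficients are never compared here, so only rearrangements without cancellation can be
    -- proved. They suffice to construct the coefficient morphism of the stronger solver.
    module Weak = Algebra.Solver.Ring (AlmostCommutativeRing.rawRing (fromCommutativeRing R))
      (fromCommutativeRing R) (-raw-almostCommutative⟶ (fromCommutativeRing R)) (λ _ _ → nothing)

    reduce : ℕ × ℕ → ℕ × ℕ
    reduce (a , b) = a ℕ.∸ b , b ℕ.∸ a

    differences : RawRing _ _
    differences = record
      { Carrier = ℕ × ℕ
      ; _≈_     = _≡_
      ; _+_     = λ (a , b) (c , d) → reduce (a ℕ.+ c , b ℕ.+ d)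
      ; _*_     = λ (a , b) (c , d) → reduce (a ℕ.* c ℕ.+ b ℕ.* d , a ℕ.* d ℕ.+ b ℕ.* c)
      ; -_      = λ (a , b) → b , a
      ; 0#      = 0 , 0
      ; 1#      = 1 , 0
      }

    ⟦_⟧ : ℕ × ℕ → Carrier
    ⟦ a , b ⟧ = a · 1# - b · 1#

    ⟦⟧-cong : ∀ a b c d → a ℕ.+ d ≡ c ℕ.+ b → ⟦ a , b ⟧ ≈ ⟦ c , d ⟧
    ⟦⟧-cong a b c d eq = begin
      a · 1# - b · 1#                             ≈⟨ sym (+-identityʳ _) ⟩
      (a · 1# - b · 1#) + 0#                      ≈⟨ +-congˡ (sym (-‿inverseʳ (d · 1#))) ⟩
      (a · 1# - b · 1#) + (d · 1# - d · 1#)       ≈⟨ regroup (a · 1#) (b · 1#) (d · 1#) ⟩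
      (a · 1# + d · 1#) - (b · 1# + d · 1#)       ≈⟨ +-congʳ (sym (×-homo-+ 1# a d)) ⟩
      (a ℕ.+ d) · 1#    - (b · 1# + d · 1#)       ≈⟨ +-congʳ (reflexive (≡.cong (_· 1#) eq)) ⟩
      (c ℕ.+ b) · 1#    - (b · 1# + d · 1#)       ≈⟨ +-congʳ (×-homo-+ 1# c b) ⟩
      (c · 1# + b · 1#) - (b · 1# + d · 1#)       ≈⟨ regroup′ (c · 1#) (b · 1#) (d · 1#) ⟩
      (c · 1# - d · 1#) + (b · 1# - b · 1#)       ≈⟨ +-congˡ (-‿inverseʳ (b · 1#)) ⟩
      (c · 1# - d · 1#) + 0#                      ≈⟨ +-identityʳ _ ⟩
      c · 1# - d · 1#                             ∎
      where
      regroup : ∀ w x z → (w - x) + (z - z) ≈ (w + z) - (x + z)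
      regroup = Weak.solve 3 (λ w x z → (w :- x) :+ (z :- z) := (w :+ z) :- (x :+ z)) refl
        where open Weak
      regroup′ : ∀ y x z → (y + x) - (x + z) ≈ (y - z) + (x - x)
      regroup′ = Weak.solve 3 (λ y x z → (y :+ x) :- (x :+ z) := (y :- z) :+ (x :- x)) refl
        where open Weak

    ⟦reduce⟧ : ∀ a b → ⟦ reduce (a , b) ⟧ ≈ ⟦ a , b ⟧
    ⟦reduce⟧ a b = ⟦⟧-cong (a ℕ.∸ b) (b ℕ.∸ a) a b (∸-swap a b)
      where
      ∸-swap : ∀ a b → a ℕ.∸ b ℕ.+ b ≡ a ℕ.+ (b ℕ.∸ a)
      ∸-swap zero    zero    = ≡.refl
      ∸-swap zero    (suc b) = ≡.refl
      ∸-swap (suc a) zero    = ≡.refl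
      ∸-swap (suc a) (suc b) = ≡.trans (ℕ.+-suc (a ℕ.∸ b) b) (≡.cong suc (∸-swap a b))

    +-homo : ∀ x y → ⟦ RawRing._+_ differences x y ⟧ ≈ ⟦ x ⟧ + ⟦ y ⟧
    +-homo (a , b) (c , d) = trans (trans (⟦reduce⟧ (a ℕ.+ c) (b ℕ.+ d))
      (+-cong (×-homo-+ 1# a c) (-‿cong (×-homo-+ 1# b d))))
      (Weak.solve 4 (λ w x y z → (w :+ y) :- (x :+ z) := (w :- x) :+ (y :- z))
                  refl (a · 1#) (b · 1#) (c · 1#) (d · 1#))
      where open Weak

    *-homo : ∀ x y → ⟦ RawRing._*_ differences x y ⟧ ≈ ⟦ x ⟧ * ⟦ y ⟧
    *-homo (a , b) (c , d) = trans (trans (⟦reduce⟧ (a ℕ.* c ℕ.+ b ℕ.* d) (a ℕ.* d ℕ.+ b ℕ.* c))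
      (+-cong (expand a c b d) (-‿cong (expand a d b c))))
      (product (a · 1#) (b · 1#) (c · 1#) (d · 1#))
      where
      expand : ∀ a c b d → (a ℕ.* c ℕ.+ b ℕ.* d) · 1# ≈ a · 1# * c · 1# + b · 1# * d · 1#
      expand a c b d = trans (×-homo-+ 1# (a ℕ.* c) (b ℕ.* d)) (+-cong (×1-homo-* a c) (×1-homo-* b d))
      product : ∀ w x y z → (w * y + x * z) - (w * z + x * y) ≈ (w - x) * (y - z)
      -- Expanded by hand, because the product of two negated terms needs (-1)(-1) = 1 among the
      -- coefficients, which `Weak` cannot decide.
      product w x y z = begin
        (w * y + x * z) - (w * z + x * y)
          ≈⟨ Weak.solve 4 (λ s t u v → (s Weak.:+ v) Weak.:- (t Weak.:+ u)
                                     Weak.:= (s Weak.:- t) Weak.:+ (v Weak.:- u))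
                        refl (w * y) (w * z) (x * y) (x * z) ⟩
        (w * y - w * z) + (x * z - x * y)
          ≈⟨ +-congˡ (+-comm _ _) ⟩
        (w * y - w * z) + (- (x * y) + x * z)
          ≈⟨ +-cong (+-congˡ (-‿distribʳ-* w z)) (+-cong (-‿distribˡ-* x y) (sym (-x*-y x z))) ⟩
        (w * y + w * - z) + (- x * y + - x * - z)
          ≈⟨ sym (+-cong (distribˡ w y (- z)) (distribˡ (- x) y (- z))) ⟩
        w * (y - z) + - x * (y - z)
          ≈⟨ sym (distribʳ (y - z) w (- x)) ⟩
        (w - x) * (y - z) ∎
        where
        -x*-y : ∀ x y → - x * - y ≈ x * y
        -x*-y x y = trans (sym (-‿distribˡ-* x (- y)))
                          (trans (-‿cong (sym (-‿distribʳ-* x y))) (-‿involutive (x * y)))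

    morphism : differences -Raw-AlmostCommutative⟶ fromCommutativeRing R
    morphism = record
      { ⟦_⟧    = ⟦_⟧
      ; +-homo = +-homo
      ; *-homo = *-homo
      ; -‿homo = λ (a , b) → sym (⁻¹-anti-homo‿- (a · 1#) (b · 1#))
      ; 0-homo = -‿inverseʳ 0#
      ; 1-homo = trans (+-cong (+-identityʳ 1#) -0#≈0#) (+-identityʳ 1#)
      }

    equal? : (x y : ℕ × ℕ) → Maybe (⟦ x ⟧ ≈ ⟦ y ⟧)
    equal? (a , b) (c , d) with a ℕ.+ d ℕ.≟ c ℕ.+ b
    ... | no  _  = nothing
    ... | yes eq = just (⟦⟧-cong a b c d eq)

  open Algebra.Solver.Ring differences (fromCommutativeRing R) morphism equal? public
    using (solve; _:+_; _:*_; _:-_; :-_; _:=_)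

-- Inverses and characteristic in a finite field.

module FieldProperties {c ℓ q} (F : FiniteField c ℓ q) where
  open FiniteField F hiding (zero)
  open Mult semiring using (×1-homo-*)
  open Sum semiring using (sum; sum-syntax; sum-cong-≋; ∑-distrib-+; sum-permute; sum-replicate)
  open RingProperties ring using (+-cancelˡ)
  open SetoidReasoning setoid

  ⁻¹-inverseˡ : ∀ {x} → ¬ x ≈ 0# → x ⁻¹ * x ≈ 1#
  ⁻¹-inverseˡ {x} x≉0 with x ≟ 0#
  ... | yes x≈0 = contradiction x≈0 x≉0
  ... | no  x≉0 = proj₂ (inverse x x≉0)

  ⁻¹-unique : ∀ {x y} → ¬ x ≈ 0# → y * x ≈ 1# → x ⁻¹ ≈ y
  ⁻¹-unique {x} {y} x≉0 yx≈1 = begin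
    x ⁻¹           ≈⟨ sym (*-identityˡ _) ⟩
    1# * x ⁻¹      ≈⟨ *-congʳ (sym yx≈1) ⟩
    y * x * x ⁻¹   ≈⟨ *-assoc y x _ ⟩
    y * (x * x ⁻¹) ≈⟨ *-congˡ (trans (*-comm x _) (⁻¹-inverseˡ x≉0)) ⟩
    y * 1#         ≈⟨ *-identityʳ y ⟩
    y              ∎

  x*y≈0⇒y≈0 : ∀ {x y} → ¬ x ≈ 0# → x * y ≈ 0# → y ≈ 0#
  x*y≈0⇒y≈0 {x} {y} x≉0 xy≈0 = begin
    y              ≈⟨ sym (*-identityˡ y) ⟩
    1# * y         ≈⟨ *-congʳ (sym (⁻¹-inverseˡ x≉0)) ⟩
    x ⁻¹ * x * y   ≈⟨ *-assoc _ x y ⟩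
    x ⁻¹ * (x * y) ≈⟨ *-congˡ xy≈0 ⟩
    x ⁻¹ * 0#      ≈⟨ zeroʳ _ ⟩
    0#             ∎

  *-≉0 : ∀ {x y} → ¬ x ≈ 0# → ¬ y ≈ 0# → ¬ x * y ≈ 0#
  *-≉0 x≉0 y≉0 = y≉0 ∘ x*y≈0⇒y≈0 x≉0

  fromℕ-∣ : ∀ {m n} → m ∣ n → fromℕ m ≈ 0# → fromℕ n ≈ 0#
  fromℕ-∣ {m} (divides k ≡.refl) m≈0 = trans (×1-homo-* k m) (trans (*-congˡ m≈0) (zeroʳ _))

  -- Translation by 1 permutes the field, so the sum of all q elements is
  -- unchanged by adding 1 to each of them.
  fromℕ-order≈0 : fromℕ q ≈ 0#
  fromℕ-order≈0 = +-cancelˡ total (fromℕ q) 0# (begin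
    total + fromℕ q              ≈⟨ +-congˡ (sym (sum-replicate q)) ⟩
    total + ∑[ _ < q ] 1#        ≈⟨ sym (∑-distrib-+ from (λ _ → 1#)) ⟩
    ∑[ i < q ] (from i + 1#)     ≈⟨ sum-cong-≋ (λ i → sym (strictlyInverseʳ (from i + 1#))) ⟩
    ∑[ i < q ] from (shift 1# i) ≈⟨ sym (sum-permute from (permutation (shift 1#) (shift (- 1#))
                                          (undo (- 1#) 1# (-‿inverseˡ 1#)) (undo 1# (- 1#) (-‿inverseʳ 1#)))) ⟩
    total                        ≈⟨ sym (+-identityʳ total) ⟩
    total + 0#                   ∎)
    where
    open Inverse finite using (to; from; to-cong; strictlyInverseˡ; strictlyInverseʳ)
    total : Carrier
    total = sum from
    shift : Carrier → Fin q → Fin q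
    shift t i = to (from i + t)
    undo : ∀ s t → s + t ≈ 0# → ∀ i → shift t (shift s i) ≡ i
    undo s t s+t≈0 i = ≡.trans (to-cong (begin
      from (to (from i + s)) + t ≈⟨ +-congʳ (strictlyInverseʳ (from i + s)) ⟩
      from i + s + t             ≈⟨ +-assoc (from i) s t ⟩
      from i + (s + t)           ≈⟨ +-congˡ s+t≈0 ⟩
      from i + 0#                ≈⟨ +-identityʳ (from i) ⟩
      from i                     ∎)) (strictlyInverseˡ i)

  -- For q = 2k + 1, the equation 2 = 0 in the field would give q = 1 there, whereas `fromℕ-order≈0`
  -- gives q = 0.
  odd⇒2≉0 : ¬ (2 ∣ q) → ¬ fromℕ 2 ≈ 0#
  odd⇒2≉0 2∤q 2≈0 with q ℕ.% 2 in rem | ℕ.m%n<n q 2 | ℕ.m≡m%n+[m/n]*n q 2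
  ... | 0 | _ | _  = 2∤q (m%n≡0⇒n∣m q 2 rem)
  ... | 1 | _ | eq = 0≉1 (begin
    0#                                     ≈⟨ sym fromℕ-order≈0 ⟩
    fromℕ q                                ≈⟨ reflexive (≡.cong fromℕ eq) ⟩
    1# + fromℕ (q ℕ./ 2 ℕ.* 2)             ≈⟨ +-congˡ (fromℕ-∣ (divides (q ℕ./ 2) ≡.refl) 2≈0) ⟩
    1# + 0#                                ≈⟨ +-identityʳ 1# ⟩
    1#                                     ∎)
  ... | suc (suc _) | ℕ.s≤s (ℕ.s≤s ()) | _

-- Linear algebra over a finite field.

module LinearAlgebraProperties {c ℓ q} (F : FiniteField c ℓ q) where
  open FiniteField F hiding (zero)
  open LinearAlgebra F
  open Sum semiring
    using (sum; sum-syntax; sum-cong-≋; ∑-comm; *-distribˡ-sum; *-distribʳ-sum; sum-replicate-zero)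
  open PairSum +-commutativeMonoid using (sum-pointMass)
  open DifferenceSolver commutativeRing
  open SetoidReasoning setoid

  ∑-zero : ∀ {n} {f : Fin n → Carrier} → (∀ i → f i ≈ 0#) → ∑[ i < n ] f i ≈ 0#
  ∑-zero {n} f≈0 = trans (sum-cong-≋ f≈0) (sum-replicate-zero n)

  ∑-distrib-- : ∀ {n} (f g : Fin n → Carrier) →
                ∑[ i < n ] (f i - g i) ≈ ∑[ i < n ] f i - ∑[ i < n ] g i
  ∑-distrib-- {zero}  f g = sym (-‿inverseʳ 0#)
  ∑-distrib-- {suc n} f g = trans (+-congˡ (∑-distrib-- (f ∘ suc) (g ∘ suc)))
    (solve 4 (λ w x y z → (w :- x) :+ (y :- z) := (w :+ y) :- (x :+ z)) refl
           (f zero) (g zero) (sum (f ∘ suc)) (sum (g ∘ suc)))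

  -- The scalar α A β bracketed in its two ways. With it, a relation among the rows of `A` passes to
  -- any product with left factor `A`.
  ∑-assoc : ∀ {m n} (α : Fin m → Carrier) (A : Matrix m n) (β : Fin n → Carrier) →
            ∑[ i < m ] (α i * ∑[ l < n ] (A i l * β l)) ≈ ∑[ l < n ] (∑[ i < m ] (α i * A i l) * β l)
  ∑-assoc {m} {n} α A β = begin
    ∑[ i < m ] (α i * ∑[ l < n ] (A i l * β l))
      ≈⟨ sum-cong-≋ (λ i → trans (*-distribˡ-sum {n} (α i) _)
                                 (sum-cong-≋ (λ l → sym (*-assoc (α i) (A i l) (β l))))) ⟩
    ∑[ i < m ] ∑[ l < n ] (α i * A i l * β l)
      ≈⟨ ∑-comm (λ i l → α i * A i l * β l) ⟩
    ∑[ l < n ] ∑[ i < m ] (α i * A i l * β l)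
      ≈⟨ sum-cong-≋ (λ l → sym (*-distribʳ-sum {m} (β l) _)) ⟩
    ∑[ l < n ] (∑[ i < m ] (α i * A i l) * β l) ∎

  -- The search defining `rank` runs downward from the number of rows, so it stops at once, with
  -- `id` selecting all rows.
  rank-full : ∀ {m n} (M : Matrix m n) → LinearlyIndependent M → rank M ≡ m
  rank-full {zero}  M li = ≡.refl
  rank-full {suc m} M li with hasIndependentRows? M (suc m)
  ... | yes _  = ≡.refl
  ... | no ¬li = contradiction (id , li) ¬li

  -- An injective endomorphism of the finite space Fⁿ is surjective.
  linearlyIndependent-ᵀ : ∀ {n} (A : Matrix n n) → LinearlyIndependent A → LinearlyIndependent (A ᵀ)
  -- Surjectivity provides a row vector `u` with u A = `e`, the unit vector at `m`. Then α m = e α =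
  -- (u A) α = u (A α) = 0.
  linearlyIndependent-ᵀ {n} A li α αA≈0 m = begin
    α m
      ≈⟨ sym (sum-pointMass m α) ⟩
    ∑[ j < n ] (if does (m Fin.≟ j) then α j else 0#)
      ≈⟨ sum-cong-≋ (λ j → sym (eᵢ*x (does (m Fin.≟ j)) (α j))) ⟩
    ∑[ j < n ] (e j * α j)
      ≈⟨ sum-cong-≋ (λ j → *-congʳ (sym (u-image j))) ⟩
    ∑[ j < n ] (∑[ i < n ] (u i * A i j) * α j)
      ≈⟨ sym (∑-assoc u A α) ⟩
    ∑[ i < n ] (u i * ∑[ j < n ] (A i j * α j))
      ≈⟨ ∑-zero (λ i → trans (*-congˡ (trans (sum-cong-≋ (λ j → *-comm (A i j) (α j))) (αA≈0 i)))
                             (zeroʳ (u i))) ⟩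
    0# ∎
    where
    open Inverse finite using (to; from; to-cong; strictlyInverseˡ; strictlyInverseʳ)

    e : Fin n → Carrier
    e j = if does (m Fin.≟ j) then 1# else 0#

    eᵢ*x : ∀ b x → (if b then 1# else 0#) * x ≈ (if b then x else 0#)
    eᵢ*x true  x = *-identityˡ x
    eᵢ*x false x = zeroˡ x

    decode : Fin (q ℕ.^ n) → Fin n → Carrier
    decode x i = from (finToFun x i)

    image : Fin (q ℕ.^ n) → Fin n → Carrier
    image x j = ∑[ i < n ] (decode x i * A i j)

    -- The map x ↦ x A on row vectors, transported to an enumeration of Fⁿ so that the pigeonhole
    -- principle applies.
    φ : Fin (q ℕ.^ n) → Fin (q ℕ.^ n)
    φ x = funToFin (to ∘ image x)

    to≡⇒≈ : ∀ {x y} → to x ≡ to y → x ≈ y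
    to≡⇒≈ {x} {y} eq =
      trans (sym (strictlyInverseʳ x)) (trans (reflexive (≡.cong from eq)) (strictlyInverseʳ y))

    funToFin-cong : ∀ {k} {f g : Fin k → Fin q} → (∀ i → f i ≡ g i) → funToFin f ≡ funToFin g
    funToFin-cong {zero}  f≗g = ≡.refl
    funToFin-cong {suc k} f≗g = ≡.cong₂ Fin.combine (f≗g zero) (funToFin-cong (f≗g ∘ suc))

    φ-image : ∀ x j → finToFun (φ x) j ≡ to (image x j)
    φ-image x = Fin.finToFun-funToFin (to ∘ image x)

    φ-injective : Injective _≡_ _≡_ φ
    φ-injective {x} {y} φx≡φy = ≡.trans (≡.sym (Fin.funToFin-finToFin {n} {q} x))
      (≡.trans (funToFin-cong digits) (Fin.funToFin-finToFin {n} {q} y))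
      where
      image≈ : ∀ j → image x j ≈ image y j
      image≈ j = to≡⇒≈ (≡.trans (≡.sym (φ-image x j))
                        (≡.trans (≡.cong (λ z → finToFun z j) φx≡φy) (φ-image y j)))
      difference : ∀ i → decode x i - decode y i ≈ 0#
      difference = li (λ i → decode x i - decode y i) (λ j → begin
        ∑[ i < n ] ((decode x i - decode y i) * A i j)
          ≈⟨ sum-cong-≋ (λ i → solve 3 (λ s t a → (s :- t) :* a := s :* a :- t :* a) refl
                                       (decode x i) (decode y i) (A i j)) ⟩
        ∑[ i < n ] (decode x i * A i j - decode y i * A i j)
          ≈⟨ ∑-distrib-- {n} _ _ ⟩
        image x j - image y j
          ≈⟨ +-congʳ (image≈ j) ⟩
        image y j - image y j
          ≈⟨ -‿inverseʳ _ ⟩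
        0# ∎)
      digits : ∀ i → finToFun {q} {n} x i ≡ finToFun {q} {n} y i
      digits i = ≡.trans (≡.sym (strictlyInverseˡ _)) (≡.trans (to-cong (begin
        decode x i                             ≈⟨ solve 2 (λ s t → s := t :+ (s :- t)) refl
                                                          (decode x i) (decode y i) ⟩
        decode y i + (decode x i - decode y i) ≈⟨ +-congˡ (difference i) ⟩
        decode y i + 0#                        ≈⟨ +-identityʳ _ ⟩
        decode y i                             ∎)) (strictlyInverseˡ _))

    preimage : ∃ λ x → φ x ≡ funToFin (to ∘ e)
    preimage = injective⇒surjective φ-injective (funToFin (to ∘ e))

    u : Fin n → Carrier
    u = decode (proj₁ preimage)

    u-image : ∀ j → ∑[ i < n ] (u i * A i j) ≈ e j
    u-image j = to≡⇒≈ (≡.trans (≡.sym (φ-image (proj₁ preimage) j))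
      (≡.trans (≡.cong (λ z → finToFun z j) (proj₂ preimage)) (Fin.finToFun-funToFin (to ∘ e) j)))

-- Quadratic identities for midpoints, and sums over pairs when n = 0 in the field.

module MidpointIdentities {c ℓ q} (F : FiniteField c ℓ q)
  (2≉0 : ¬ FiniteField._≈_ F (FiniteField.fromℕ F 2) (FiniteField.0# F)) where
  open FiniteField F hiding (zero)
  open Geometry F
  open FieldProperties F
  open LinearAlgebraProperties F
  open Sum semiring using (sum; sum-syntax; sum-cong-≋; ∑-distrib-+; *-distribˡ-sum; *-distribʳ-sum; sum-replicate)
  open PairSum +-commutativeMonoid
  open ListSum +-commutativeMonoid
  open DifferenceSolver commutativeRing
  open SetoidReasoning setoid

  ½ : Carrier
  ½ = fromℕ 2 ⁻¹

  ½+½≈1 : ½ + ½ ≈ 1#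
  ½+½≈1 = begin
    ½ + ½                   ≈⟨ sym (+-cong (*-identityʳ ½)
                                           (trans (*-congˡ (+-identityʳ 1#)) (*-identityʳ ½))) ⟩
    ½ * 1# + ½ * (1# + 0#)  ≈⟨ sym (distribˡ ½ 1# (1# + 0#)) ⟩
    ½ * fromℕ 2             ≈⟨ ⁻¹-inverseˡ 2≉0 ⟩
    1#                      ∎

  [½+½]* : ∀ x → (½ + ½) * x ≈ x
  [½+½]* x = trans (*-congʳ ½+½≈1) (*-identityˡ x)

  ½≉0 : ¬ ½ ≈ 0#
  ½≉0 ½≈0 = 0≉1 (trans (sym (+-identityʳ 0#)) (trans (sym (+-cong ½≈0 ½≈0)) ½+½≈1))

  x+x≈0⇒x≈0 : ∀ {x} → x + x ≈ 0# → x ≈ 0#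
  x+x≈0⇒x≈0 {x} x+x≈0 = begin
    x             ≈⟨ sym ([½+½]* x) ⟩
    (½ + ½) * x   ≈⟨ solve 2 (λ h x → (h :+ h) :* x := h :* (x :+ x)) refl ½ x ⟩
    ½ * (x + x)   ≈⟨ *-congˡ x+x≈0 ⟩
    ½ * 0#        ≈⟨ zeroʳ ½ ⟩
    0#            ∎

  1/4≈½*½ : fromℕ 4 ⁻¹ ≈ ½ * ½
  1/4≈½*½ = ⁻¹-unique (*-≉0 2≉0 2≉0 ∘ trans (sym 4≈2*2)) (begin
    ½ * ½ * fromℕ 4               ≈⟨ *-congˡ 4≈2*2 ⟩
    ½ * ½ * (fromℕ 2 * fromℕ 2)   ≈⟨ solve 2 (λ h t → h :* h :* (t :* t) := (h :* t) :* (h :* t))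
                                             refl ½ (fromℕ 2) ⟩
    (½ * fromℕ 2) * (½ * fromℕ 2) ≈⟨ *-cong (⁻¹-inverseˡ 2≉0) (⁻¹-inverseˡ 2≉0) ⟩
    1# * 1#                       ≈⟨ *-identityˡ 1# ⟩
    1#                            ∎)
    where
    open Mult semiring using (×1-homo-*)
    4≈2*2 : fromℕ 4 ≈ fromℕ 2 * fromℕ 2
    4≈2*2 = ×1-homo-* 2 2

  module _ {d : ℕ} where

    Q-cong : {x y : Point d} → x ≋ y → Q x ≈ Q y
    Q-cong x≋y = sum-cong-≋ (λ i → *-cong (x≋y i) (x≋y i))

    −-cong : {x x′ y y′ : Point d} → x ≋ x′ → y ≋ y′ → (x − y) ≋ (x′ − y′)
    −-cong x≋x′ y≋y′ i = +-cong (x≋x′ i) (-‿cong (y≋y′ i))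

    ≋⇒Q≈0 : {x y : Point d} → x ≋ y → Q (x − y) ≈ 0#
    ≋⇒Q≈0 {x} {y} x≋y = ∑-zero (λ i → trans (*-congʳ (trans (+-congʳ (x≋y i)) (-‿inverseʳ (y i)))) (zeroˡ _))

    -- Only mutual distances of the endpoints appear on the right, ready for the equilateral
    -- hypothesis. In each coordinate the bracket is the expansion of (x + y - u - v)².
    Q-midpoints : (x y u v : Point d) → Q (midpoint x y − midpoint u v) ≈
      ½ * ½ * (((Q (x − u) + Q (x − v)) + (Q (y − u) + Q (y − v))) - (Q (x − y) + Q (u − v)))
    Q-midpoints x y u v = begin
      Q (midpoint x y − midpoint u v)
        ≈⟨ sum-cong-≋ (λ i → solve 5 (λ h x y u v →
             ((x :+ y) :* h :- (u :+ v) :* h) :* ((x :+ y) :* h :- (u :+ v) :* h) :=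
             h :* h :* (((x :- u) :* (x :- u) :+ (x :- v) :* (x :- v)
                         :+ ((y :- u) :* (y :- u) :+ (y :- v) :* (y :- v)))
                        :- ((x :- y) :* (x :- y) :+ (u :- v) :* (u :- v))))
             refl ½ (x i) (y i) (u i) (v i)) ⟩
      ∑[ i < d ] (½ * ½ * (((s x u i + s x v i) + (s y u i + s y v i)) - (s x y i + s u v i)))
        ≈⟨ sym (*-distribˡ-sum {d} (½ * ½) _) ⟩
      ½ * ½ * ∑[ i < d ] (((s x u i + s x v i) + (s y u i + s y v i)) - (s x y i + s u v i))
        ≈⟨ *-congˡ (trans (∑-distrib-- {d} _ _)
             (+-cong (trans (∑-distrib-+ {d} _ _)
                            (+-cong (∑-distrib-+ (s x u) (s x v)) (∑-distrib-+ (s y u) (s y v))))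
                     (-‿cong (∑-distrib-+ (s x y) (s u v))))) ⟩
      ½ * ½ * (((Q (x − u) + Q (x − v)) + (Q (y − u) + Q (y − v))) - (Q (x − y) + Q (u − v))) ∎
      where
      s : Point d → Point d → Fin d → Carrier
      s x y i = (x − y) i * (x − y) i

    -- The parallelogram law, solved for Q(x + y) and divided by 4.
    Q-midpoint : (x y : Point d) →
                 Q (midpoint x y) ≈ ½ * ½ * (((Q x + Q x) + (Q y + Q y)) - Q (x − y))
    Q-midpoint x y = begin
      Q (midpoint x y)
        ≈⟨ sum-cong-≋ (λ i → solve 3 (λ h x y →
             ((x :+ y) :* h) :* ((x :+ y) :* h) :=
             h :* h :* (((x :* x :+ x :* x) :+ (y :* y :+ y :* y)) :- (x :- y) :* (x :- y)))
             refl ½ (x i) (y i)) ⟩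
      ∑[ i < d ] (½ * ½ * (((s x i + s x i) + (s y i + s y i)) - s (x − y) i))
        ≈⟨ sym (*-distribˡ-sum {d} (½ * ½) _) ⟩
      ½ * ½ * ∑[ i < d ] (((s x i + s x i) + (s y i + s y i)) - s (x − y) i)
        ≈⟨ *-congˡ (trans (∑-distrib-- {d} _ _)
             (+-congʳ (trans (∑-distrib-+ {d} _ _)
                             (+-cong (∑-distrib-+ (s x) (s x)) (∑-distrib-+ (s y) (s y)))))) ⟩
      ½ * ½ * (((Q x + Q x) + (Q y + Q y)) - Q (x − y)) ∎
      where
      s : Point d → Fin d → Carrier
      s x i = x i * x i

  module _ {n} (n≈0 : fromℕ n ≈ 0#) where

    ∑-const : ∀ x → ∑[ _ < n ] x ≈ 0#
    ∑-const x = begin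
      ∑[ _ < n ] x          ≈⟨ sum-cong-≋ {n} (λ _ → sym (*-identityˡ x)) ⟩
      ∑[ _ < n ] (1# * x)   ≈⟨ sym (*-distribʳ-sum {n} x (λ _ → 1#)) ⟩
      (∑[ _ < n ] 1#) * x   ≈⟨ *-congʳ (trans (sum-replicate n) n≈0) ⟩
      0# * x                ≈⟨ zeroˡ x ⟩
      0#                    ∎

    -- The left-hand sum is (n ∙ ∑ g a) + (n ∙ ∑ g a) + 2 (∑ g) (∑ a), and n ≈ 0.
    ∑∑-bilinear : (g a : Fin n → Carrier) →
                  ∑[ i < n ] ∑[ k < n ] ((g i + g k) * (a i + a k)) ≈ sum g * sum a + sum g * sum a
    ∑∑-bilinear g a = begin
      ∑[ i < n ] ∑[ k < n ] ((g i + g k) * (a i + a k))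
        ≈⟨ sum-cong-≋ inner ⟩
      ∑[ i < n ] (Γ + (g i * sum a + sum g * a i))
        ≈⟨ ∑-distrib-+ {n} _ _ ⟩
      ∑[ _ < n ] Γ + ∑[ i < n ] (g i * sum a + sum g * a i)
        ≈⟨ trans (+-congʳ (∑-const Γ)) (+-identityˡ _) ⟩
      ∑[ i < n ] (g i * sum a + sum g * a i)
        ≈⟨ ∑-distrib-+ {n} _ _ ⟩
      ∑[ i < n ] (g i * sum a) + ∑[ i < n ] (sum g * a i)
        ≈⟨ sym (+-cong (*-distribʳ-sum (sum a) g) (*-distribˡ-sum (sum g) a)) ⟩
      sum g * sum a + sum g * sum a ∎
      where
      Γ : Carrier
      Γ = ∑[ k < n ] (g k * a k)
      inner : ∀ i → ∑[ k < n ] ((g i + g k) * (a i + a k)) ≈ Γ + (g i * sum a + sum g * a i)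
      inner i = begin
        ∑[ k < n ] ((g i + g k) * (a i + a k))
          ≈⟨ sum-cong-≋ (λ k → solve 4 (λ gi gk ai ak → (gi :+ gk) :* (ai :+ ak) :=
               gi :* ai :+ (gk :* ak :+ (gi :* ak :+ gk :* ai))) refl (g i) (g k) (a i) (a k)) ⟩
        ∑[ k < n ] (g i * a i + (g k * a k + (g i * a k + g k * a i)))
          ≈⟨ trans (∑-distrib-+ {n} _ _) (trans (+-congʳ (∑-const (g i * a i))) (+-identityˡ _)) ⟩
        ∑[ k < n ] (g k * a k + (g i * a k + g k * a i))
          ≈⟨ trans (∑-distrib-+ {n} _ _) (+-congˡ (∑-distrib-+ {n} _ _)) ⟩
        Γ + (∑[ k < n ] (g i * a k) + ∑[ k < n ] (g k * a i))
          ≈⟨ +-congˡ (sym (+-cong (*-distribˡ-sum (g i) a) (*-distribʳ-sum (a i) g))) ⟩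
        Γ + (g i * sum a + sum g * a i) ∎

    -- Applying `∑-orderedPairs` to the array (g i + g k)(a i + a k), whose diagonal sum is four
    -- times the pairing, and evaluating the full sum by `∑∑-bilinear`, shows that four times the
    -- pairing vanishes. Since 2 ≠ 0, so does the pairing.
    pairing≈0 : (g a : Fin n → Carrier) → sum g * sum a ≈ 0# →
                ∑ₗ (orderedPairs n) (uncurry (λ i k → (g i + g k) * (a i + a k))) ≈ 0# →
                ∑[ i < n ] (g i * a i) ≈ 0#
    pairing≈0 g a GA≈0 S≈0 = x+x≈0⇒x≈0 (x+x≈0⇒x≈0 (begin
      (Γ + Γ) + (Γ + Γ)
        ≈⟨ sym (trans (∑-distrib-+ {n} _ _) (+-cong (∑-distrib-+ {n} _ _) (∑-distrib-+ {n} _ _))) ⟩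
      ∑[ i < n ] ((g i * a i + g i * a i) + (g i * a i + g i * a i))
        ≈⟨ sum-cong-≋ (λ i → solve 2 (λ g a →
             (g :* a :+ g :* a) :+ (g :* a :+ g :* a) := (g :+ g) :* (a :+ a)) refl (g i) (a i)) ⟩
      ∑[ i < n ] ((g i + g i) * (a i + a i))
        ≈⟨ sym (trans (+-congʳ (trans (+-cong S≈0 S≈0) (+-identityˡ 0#))) (+-identityˡ _)) ⟩
      _
        ≈⟨ ∑-orderedPairs (λ i k → (g i + g k) * (a i + a k))
                          (λ i k → *-cong (+-comm (g i) (g k)) (+-comm (a i) (a k))) ⟩
      ∑[ i < n ] ∑[ k < n ] ((g i + g k) * (a i + a k))
        ≈⟨ ∑∑-bilinear g a ⟩
      sum g * sum a + sum g * sum a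
        ≈⟨ trans (+-cong GA≈0 GA≈0) (+-identityˡ 0#) ⟩
      0# ∎))
      where
      Γ : Carrier
      Γ = ∑[ i < n ] (g i * a i)

-- Distinctness of images, and the integer arithmetic of the bound.

AllPairs-map⁺ : ∀ {a b p r} {A : Set a} {B : Set b} {P : A → Set p} {R : B → B → Set r} (f : A → B) →
                (∀ {x y} → P x → P y → x ≢ y → R (f x) (f y)) →
                ∀ {xs} → All P xs → Unique xs → AllPairs R (map f xs)
AllPairs-map⁺ f h []         []         = []
AllPairs-map⁺ f h (px ∷ pxs) (x≢ ∷ xs!) =
  All.map⁺ (All.zipWith (λ (py , x≢y) → h px py x≢y) (pxs , x≢)) ∷ AllPairs-map⁺ f h pxs xs!

difference≡1 : ∀ {r s n} → r ≡ suc n → s ≡ n → + r ℤ.- + s ≡ 1ℤ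
difference≡1 {n = n} ≡.refl ≡.refl =
  ≡.trans (ℤ.+-assoc 1ℤ (+ n) (ℤ.- + n)) (≡.cong (λ z → 1ℤ ℤ.+ z) (ℤ.+-inverseʳ (+ n)))

-- The rank difference 1 cancels the - 1 in the bound.
bound≡binomial : ∀ {b r s n} → r ≡ suc n → s ≡ n → + b ℤ.- 1ℤ ℤ.+ + r ℤ.- + s ≡ + b
bound≡binomial {b} {r} {s} r≡ s≡ = begin
  + b ℤ.- 1ℤ ℤ.+ + r ℤ.- + s     ≡⟨ ℤ.+-assoc (+ b ℤ.- 1ℤ) (+ r) (ℤ.- + s) ⟩
  + b ℤ.- 1ℤ ℤ.+ (+ r ℤ.- + s)   ≡⟨ ≡.cong (λ z → + b ℤ.- 1ℤ ℤ.+ z) (difference≡1 r≡ s≡) ⟩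
  + b ℤ.- 1ℤ ℤ.+ 1ℤ              ≡⟨ ℤ.+-assoc (+ b) (ℤ.- 1ℤ) 1ℤ ⟩
  + b ℤ.+ + 0                    ≡⟨ ℤ.+-identityʳ (+ b) ⟩
  + b                            ∎
  where open ≡.≡-Reasoning

-- Distances between midpoints of an equilateral set.

module EquilateralSets {c ℓ q} (F : FiniteField c ℓ q)
  (2≉0 : ¬ FiniteField._≈_ F (FiniteField.fromℕ F 2) (FiniteField.0# F)) where
  open FiniteField F hiding (zero)
  open LinearAlgebra F
  open Geometry F
  open FieldProperties F
  open LinearAlgebraProperties F
  open MidpointIdentities F 2≉0
  open Sum semiring using (sum; sum-syntax; sum-cong-≋; ∑-distrib-+; *-distribˡ-sum; *-distribʳ-sum)
  open PairSum +-commutativeMonoid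
  open ListSum +-commutativeMonoid
  open DifferenceSolver commutativeRing
  open SetoidReasoning setoid

  module MidpointDistances {d n} (P : Vector (Point d) n) (Δ : Carrier)
    (Δ≉0 : ¬ Δ ≈ 0#) (equilateral : IsEquilateral P Δ) where

    X : FiniteSet d
    X = midpointSet P

    mid : Fin n → Fin n → Point d
    mid i j = midpoint (P i) (P j)

    mid-comm : ∀ i j → mid i j ≋ mid j i
    mid-comm i j k = *-congʳ (+-comm (P i k) (P j k))

    Δ/2≉0 : ¬ Δ / fromℕ 2 ≈ 0#
    Δ/2≉0 = *-≉0 Δ≉0 ½≉0

    Δ/4≉0 : ¬ Δ / fromℕ 4 ≈ 0#
    Δ/4≉0 = *-≉0 Δ≉0 (*-≉0 ½≉0 ½≉0 ∘ trans (sym 1/4≈½*½))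

    Δ/4+Δ/4≈Δ/2 : Δ / fromℕ 4 + Δ / fromℕ 4 ≈ Δ / fromℕ 2
    Δ/4+Δ/4≈Δ/2 = begin
      Δ / fromℕ 4 + Δ / fromℕ 4      ≈⟨ +-cong (*-congˡ 1/4≈½*½) (*-congˡ 1/4≈½*½) ⟩
      Δ * (½ * ½) + Δ * (½ * ½)      ≈⟨ solve 2 (λ t h →
        t :* (h :* h) :+ t :* (h :* h) := (h :+ h) :* (t :* h)) refl Δ ½ ⟩
      (½ + ½) * (Δ * ½)              ≈⟨ [½+½]* (Δ * ½) ⟩
      Δ * ½                          ∎

    -- Since Δ/2 is twice Δ/4, equality would force Δ/4 = 0.
    Δ/4≉Δ/2 : ¬ Δ / fromℕ 4 ≈ Δ / fromℕ 2
    Δ/4≉Δ/2 eq = Δ/4≉0 (begin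
      t            ≈⟨ solve 1 (λ t → t := (t :+ t) :- t) refl t ⟩
      (t + t) - t  ≈⟨ +-cong Δ/4+Δ/4≈Δ/2 (-‿cong eq) ⟩
      u - u        ≈⟨ -‿inverseʳ u ⟩
      0#           ∎)
      where
      t u : Carrier
      t = Δ / fromℕ 4
      u = Δ / fromℕ 2

    -- One of the four cross distances in `Q-midpoints` is zero, so the bracket is 3Δ - 2Δ = Δ.
    Q-adjacent : ∀ {i j k} → i ≢ j → i ≢ k → j ≢ k → Q (mid i j − mid i k) ≈ Δ / fromℕ 4
    Q-adjacent {i} {j} {k} i≢j i≢k j≢k = begin
      Q (mid i j − mid i k)
        ≈⟨ Q-midpoints (P i) (P j) (P i) (P k) ⟩
      ½ * ½ * (((Q (P i − P i) + Q (P i − P k)) + (Q (P j − P i) + Q (P j − P k)))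
               - (Q (P i − P j) + Q (P i − P k)))
        ≈⟨ *-congˡ (+-cong (+-cong (trans (+-cong (≋⇒Q≈0 {x = P i} (λ _ → refl)) (equilateral i k i≢k))
                                          (+-identityˡ Δ))
                                   (+-cong (equilateral j i (i≢j ∘ ≡.sym)) (equilateral j k j≢k)))
                           (-‿cong (+-cong (equilateral i j i≢j) (equilateral i k i≢k)))) ⟩
      ½ * ½ * ((Δ + (Δ + Δ)) - (Δ + Δ))
        ≈⟨ solve 2 (λ h t → h :* h :* ((t :+ (t :+ t)) :- (t :+ t)) := t :* (h :* h)) refl ½ Δ ⟩
      Δ * (½ * ½)
        ≈⟨ *-congˡ (sym 1/4≈½*½) ⟩
      Δ / fromℕ 4 ∎

    -- All four cross distances equal Δ, so the bracket is 4Δ - 2Δ = 2Δ.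
    Q-disjoint : ∀ {i j k l} → i ≢ j → k ≢ l → i ≢ k → i ≢ l → j ≢ k → j ≢ l →
                 Q (mid i j − mid k l) ≈ Δ / fromℕ 2
    Q-disjoint {i} {j} {k} {l} i≢j k≢l i≢k i≢l j≢k j≢l = begin
      Q (mid i j − mid k l)
        ≈⟨ Q-midpoints (P i) (P j) (P k) (P l) ⟩
      ½ * ½ * (((Q (P i − P k) + Q (P i − P l)) + (Q (P j − P k) + Q (P j − P l)))
               - (Q (P i − P j) + Q (P k − P l)))
        ≈⟨ *-congˡ (+-cong (+-cong (+-cong (equilateral i k i≢k) (equilateral i l i≢l))
                                   (+-cong (equilateral j k j≢k) (equilateral j l j≢l)))
                           (-‿cong (+-cong (equilateral i j i≢j) (equilateral k l k≢l)))) ⟩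
      ½ * ½ * (((Δ + Δ) + (Δ + Δ)) - (Δ + Δ))
        ≈⟨ solve 2 (λ h t → h :* h :* (((t :+ t) :+ (t :+ t)) :- (t :+ t)) := (h :+ h) :* (t :* h))
                   refl ½ Δ ⟩
      (½ + ½) * (Δ * ½)
        ≈⟨ [½+½]* (Δ * ½) ⟩
      Δ / fromℕ 2 ∎

    IsΔ/4orΔ/2 : Carrier → Set ℓ
    IsΔ/4orΔ/2 t = t ≈ Δ / fromℕ 4 ⊎ t ≈ Δ / fromℕ 2

    -- Two different pairs share one index or none. A shared index is moved to the front of both
    -- midpoints by `mid-comm`, which reduces to `Q-adjacent`.
    Q-mid : ∀ {i j k l} → i Fin.< j → k Fin.< l → (i , j) ≢ (k , l) → IsΔ/4orΔ/2 (Q (mid i j − mid k l))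
    Q-mid {i} {j} {k} {l} i<j k<l ij≢kl with i Fin.≟ k | i Fin.≟ l | j Fin.≟ k | j Fin.≟ l
    ... | yes ≡.refl | _ | _ | _ =
      inj₁ (Q-adjacent (Fin.<⇒≢ i<j) (Fin.<⇒≢ k<l) (ij≢kl ∘ ≡.cong (i ,_)))
    -- Here k < i < j, so the two unshared indices differ.
    ... | no i≢k | yes ≡.refl | _ | _ =
      inj₁ (trans (Q-cong (−-cong (λ _ → refl) (mid-comm k i)))
                  (Q-adjacent (Fin.<⇒≢ i<j) i≢k (Fin.<⇒≢ (Fin.<-trans k<l i<j) ∘ ≡.sym)))
    ... | no i≢k | no i≢l | yes ≡.refl | _ =
      inj₁ (trans (Q-cong (−-cong (mid-comm i j) (λ _ → refl)))
                  (Q-adjacent (i≢k ∘ ≡.sym) (Fin.<⇒≢ k<l) i≢l))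
    ... | no i≢k | no i≢l | no j≢k | yes ≡.refl =
      inj₁ (trans (Q-cong (−-cong (mid-comm i j) (mid-comm k j)))
                  (Q-adjacent (i≢l ∘ ≡.sym) j≢k i≢k))
    ... | no i≢k | no i≢l | no j≢k | no j≢l =
      inj₂ (Q-disjoint (Fin.<⇒≢ i<j) (Fin.<⇒≢ k<l) i≢k i≢l j≢k j≢l)

    IsΔ/4orΔ/2⇒≉0 : ∀ {t} → IsΔ/4orΔ/2 t → ¬ t ≈ 0#
    IsΔ/4orΔ/2⇒≉0 (inj₁ t≈) = Δ/4≉0 ∘ trans (sym t≈)
    IsΔ/4orΔ/2⇒≉0 (inj₂ t≈) = Δ/2≉0 ∘ trans (sym t≈)

    -- Midpoints of different pairs are at squared distance Δ/4 or Δ/2, both nonzero, whereas equal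
    -- points are at squared distance 0.
    mids-distinct : AllPairs (λ x y → ¬ x ≋ y) (map (uncurry mid) (orderedPairs n))
    mids-distinct = AllPairs-map⁺ (uncurry mid)
      (λ i<j k<l ij≢kl → IsΔ/4orΔ/2⇒≉0 (Q-mid i<j k<l ij≢kl) ∘ ≋⇒Q≈0)
      (orderedPairs-< n) (orderedPairs-unique n)

    points-X : FiniteSet.points X ≡ map (uncurry mid) (orderedPairs n)
    points-X = deduplicate-unique (pointDecSetoid d) mids-distinct

    ∣X∣≡nC2 : ∣ X ∣ ≡ n C 2
    ∣X∣≡nC2 = ≡.trans (≡.cong length points-X)
      (≡.trans (length-map (uncurry mid) (orderedPairs n)) (length-orderedPairs n))

    ∈X⁺ : ∀ {i j} → i Fin.< j → FiniteSet._∈S X (mid i j)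
    ∈X⁺ {i} {j} i<j = ≡.subst (Any (mid i j ≋_)) (≡.sym points-X)
      (Any.map⁺ (Any.map (λ where ≡.refl _ → refl) (∈-orderedPairs i<j)))

    ∈X⁻ : ∀ {x} → FiniteSet._∈S X x → ∃ λ ij → uncurry Fin._<_ ij × x ≋ uncurry mid ij
    ∈X⁻ {x} x∈X = _ , All.lookupAny (orderedPairs-< n) (Any.map⁻ (≡.subst (Any (x ≋_)) points-X x∈X))

    squaredDistance⇒ : ∀ {t} → IsSquaredDistance X t → IsΔ/4orΔ/2 t
    squaredDistance⇒ {t} (x , y , x∈X , y∈X , x≉y , Q≈t)
      with ij , i<j , x≋ij ← ∈X⁻ x∈X | kl , k<l , y≋kl ← ∈X⁻ y∈X
      = respond (Q-mid i<j k<l ij≢kl)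
      where
      ij≢kl : ij ≢ kl
      ij≢kl ≡.refl = x≉y (λ i → trans (x≋ij i) (sym (y≋kl i)))
      t≈ : t ≈ Q (uncurry mid ij − uncurry mid kl)
      t≈ = trans (sym Q≈t) (Q-cong (−-cong x≋ij y≋kl))
      respond : IsΔ/4orΔ/2 (Q (uncurry mid ij − uncurry mid kl)) → IsΔ/4orΔ/2 t
      respond (inj₁ e) = inj₁ (trans t≈ e)
      respond (inj₂ e) = inj₂ (trans t≈ e)

    ⇒squaredDistance : ∀ {i j k l t} → i Fin.< j → k Fin.< l →
                       Q (mid i j − mid k l) ≈ t → IsΔ/4orΔ/2 t → IsSquaredDistance X t
    ⇒squaredDistance i<j k<l Q≈t t≈ =
      _ , _ , ∈X⁺ i<j , ∈X⁺ k<l , (λ x≋y → IsΔ/4orΔ/2⇒≉0 t≈ (trans (sym Q≈t) (≋⇒Q≈0 x≋y))) , Q≈t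

  -- Both values occur because `2 ≤ n` supplies four vertices: the pairs 01 and 02 realise Δ/4, the
  -- pairs 01 and 23 realise Δ/2.
  midpointSet-isTwoDistance : ∀ {d n} → 2 ℕ.≤ n → (P : Vector (Point d) (2 ℕ.+ n)) (Δ : Carrier) →
    ¬ Δ ≈ 0# → IsEquilateral P Δ → IsTwoDistance (midpointSet P) (Δ / fromℕ 4) (Δ / fromℕ 2)
  midpointSet-isTwoDistance (ℕ.s≤s (ℕ.s≤s _)) P Δ Δ≉0 equilateral =
    Δ/4≉Δ/2 , λ t → mk⇔ squaredDistance⇒ λ where
      (inj₁ t≈) → ⇒squaredDistance {zero} {suc zero} {zero} {suc (suc zero)} ℕ.z<s ℕ.z<s
        (trans (Q-adjacent (λ ()) (λ ()) (λ ())) (sym t≈)) (inj₁ t≈)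
      (inj₂ t≈) → ⇒squaredDistance {zero} {suc zero} {suc (suc zero)} {suc (suc (suc zero))}
        ℕ.z<s (ℕ.s<s (ℕ.s<s ℕ.z<s))
        (trans (Q-disjoint (λ ()) (λ ()) (λ ()) (λ ()) (λ ()) (λ ())) (sym t≈)) (inj₂ t≈)
    where open MidpointDistances P Δ Δ≉0 equilateral

  -- Nonsingularity of the Gram matrix of the midpoint set.

  module Gram {d n} (P : Vector (Point d) n) (Δ : Carrier)
    (Δ≉0 : ¬ Δ ≈ 0#) (equilateral : IsEquilateral P Δ) where
    open MidpointDistances P Δ Δ≉0 equilateral

    private
      D : ℕ
      D = 2 ℕ.+ d

    ĥ : Point d → Vector Carrier D
    ĥ x = Q x VF.∷ 1# VF.∷ x

    -- By `Q-midpoint`, Q at a midpoint is half the sum of the two endpoint values minus Δ/4. Each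
    -- endpoint takes half of that correction, hence the Δ/8 in the first entry.
    halfColumn : Point d → Vector Carrier D
    halfColumn x = (½ * Q x - ½ * (½ * ½ * Δ)) VF.∷ ½ VF.∷ (λ k → ½ * x k)

    ĥ-mid : ∀ {i k} → i ≢ k → ∀ j → ĥ (mid i k) j ≈ halfColumn (P i) j + halfColumn (P k) j
    ĥ-mid {i} {k} i≢k zero = begin
      Q (mid i k)
        ≈⟨ Q-midpoint (P i) (P k) ⟩
      ½ * ½ * (((Q (P i) + Q (P i)) + (Q (P k) + Q (P k))) - Q (P i − P k))
        ≈⟨ *-congˡ (+-congˡ (-‿cong (equilateral i k i≢k))) ⟩
      ½ * ½ * (((Q (P i) + Q (P i)) + (Q (P k) + Q (P k))) - Δ)
        ≈⟨ solve 4 (λ h x y t → h :* h :* (((x :+ x) :+ (y :+ y)) :- t)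
                                := (h :+ h) :* (h :* (x :+ y)) :- h :* h :* t)
                   refl ½ (Q (P i)) (Q (P k)) Δ ⟩
      (½ + ½) * (½ * (Q (P i) + Q (P k))) - ½ * ½ * Δ
        ≈⟨ +-cong ([½+½]* _) (-‿cong (sym ([½+½]* _))) ⟩
      ½ * (Q (P i) + Q (P k)) - (½ + ½) * (½ * ½ * Δ)
        ≈⟨ solve 4 (λ h x y t → h :* (x :+ y) :- (h :+ h) :* t
                                := (h :* x :- h :* t) :+ (h :* y :- h :* t))
                   refl ½ (Q (P i)) (Q (P k)) (½ * ½ * Δ) ⟩
      halfColumn (P i) zero + halfColumn (P k) zero ∎
    ĥ-mid _ (suc zero) = sym ½+½≈1
    ĥ-mid {i} {k} _ (suc (suc m)) =
      solve 3 (λ x y h → (x :+ y) :* h := h :* x :+ h :* y) refl (P i m) (P k m) ½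

    -- For fixed x, ½ Q(x − y) is a linear function of halfColumn y.
    polar : Point d → Vector Carrier D
    polar x = 1# VF.∷ (Q x + ½ * ½ * Δ) VF.∷ (λ k → - (x k + x k))

    -- In the constant row, ½ times the Δ/4 added to Q(x) restores the Δ/8 subtracted in
    -- `halfColumn`; the coordinate rows supply the cross term.
    ½Q-polar : ∀ x y → ∑[ j < D ] (halfColumn y j * polar x j) ≈ ½ * Q (x − y)
    ½Q-polar x y = sym (begin
      ½ * Q (x − y)
        ≈⟨ *-congˡ (trans (sum-cong-≋ (λ k → solve 2 (λ x y →
              (x :- y) :* (x :- y) := x :* x :+ (y :* y :+ y :* (:- (x :+ x)))) refl (x k) (y k)))
              (trans (∑-distrib-+ {d} _ _) (+-congˡ (∑-distrib-+ {d} _ _)))) ⟩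
      ½ * (Q x + (Q y + Z))
        ≈⟨ solve 5 (λ h x y z t → h :* (x :+ (y :+ z))
                                  := (h :* y :- h :* t) :+ (h :* (x :+ t) :+ h :* z))
                   refl ½ (Q x) (Q y) Z (½ * ½ * Δ) ⟩
      (½ * Q y - ½ * (½ * ½ * Δ)) + (½ * (Q x + ½ * ½ * Δ) + ½ * Z)
        ≈⟨ +-cong (sym (*-identityʳ _))
                  (+-congˡ (trans (*-distribˡ-sum {d} ½ _)
                                  (sum-cong-≋ {d} (λ k → sym (*-assoc ½ (y k) _))))) ⟩
      ∑[ j < D ] (halfColumn y j * polar x j) ∎)
      where
      Z : Carrier
      Z = ∑[ k < d ] (y k * (- (x k + x k)))

    -- Pairing the relation with `polar (P j)` gives zero for the sum of g k · ½ Q(P j - P k), whose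
    -- terms are g k · ½Δ except for a zero at k = j. Adding ½Δ g j fills that gap and completes the
    -- sum to ½Δ ∑ g, which vanishes by the constant row of the relation. Hence ½Δ g j = 0.
    halfColumns-independent : LinearlyIndependent (halfColumn ∘ P)
    halfColumns-independent g rel j = x*y≈0⇒y≈0 (*-≉0 ½≉0 Δ≉0) (begin
      ½ * Δ * g j
        ≈⟨ *-comm (½ * Δ) (g j) ⟩
      g j * (½ * Δ)
        ≈⟨ sym (sum-pointMass j (λ k → g k * (½ * Δ))) ⟩
      ∑[ k < n ] (if does (j Fin.≟ k) then g k * (½ * Δ) else 0#)
        ≈⟨ sym (trans (+-congʳ distances≈0) (+-identityˡ _)) ⟩
      ∑[ k < n ] (g k * (½ * Q (P j − P k)))
        + ∑[ k < n ] (if does (j Fin.≟ k) then g k * (½ * Δ) else 0#)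
        ≈⟨ sym (∑-distrib-+ {n} _ _) ⟩
      ∑[ k < n ] (g k * (½ * Q (P j − P k)) + (if does (j Fin.≟ k) then g k * (½ * Δ) else 0#))
        ≈⟨ sum-cong-≋ fill ⟩
      ∑[ k < n ] (g k * ½ * Δ)
        ≈⟨ sym (*-distribʳ-sum {n} Δ _) ⟩
      ∑[ k < n ] (g k * ½) * Δ
        ≈⟨ trans (*-congʳ (rel (suc zero))) (zeroˡ Δ) ⟩
      0# ∎)
      where
      distances≈0 : ∑[ k < n ] (g k * (½ * Q (P j − P k))) ≈ 0#
      distances≈0 = begin
        ∑[ k < n ] (g k * (½ * Q (P j − P k)))
          ≈⟨ sum-cong-≋ (λ k → *-congˡ (sym (½Q-polar (P j) (P k)))) ⟩
        ∑[ k < n ] (g k * ∑[ i < D ] (halfColumn (P k) i * polar (P j) i))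
          ≈⟨ ∑-assoc g (halfColumn ∘ P) (polar (P j)) ⟩
        ∑[ i < D ] (∑[ k < n ] (g k * halfColumn (P k) i) * polar (P j) i)
          ≈⟨ ∑-zero (λ i → trans (*-congʳ (rel i)) (zeroˡ (polar (P j) i))) ⟩
        0# ∎
      fill : ∀ k → g k * (½ * Q (P j − P k)) + (if does (j Fin.≟ k) then g k * (½ * Δ) else 0#)
                   ≈ g k * ½ * Δ
      fill k with j Fin.≟ k
      ... | yes ≡.refl = trans
        (+-congʳ (trans (*-congˡ (trans (*-congˡ (≋⇒Q≈0 {x = P j} (λ _ → refl))) (zeroʳ ½))) (zeroʳ (g j))))
        (trans (+-identityˡ _) (sym (*-assoc (g j) ½ Δ)))
      ... | no j≢k = trans (+-identityʳ _)
        (trans (*-congˡ (*-congˡ (equilateral j k j≢k))) (sym (*-assoc (g k) ½ Δ)))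

    -- The two sides compute to the same entry only once the row index is known, hence the case
    -- split.
    Ĥ-column : ∀ i l → Ĥ X i l ≈ ĥ (lookup (FiniteSet.points X) l) i
    Ĥ-column zero          l = refl
    Ĥ-column (suc zero)    l = refl
    Ĥ-column (suc (suc i)) l = refl

    gram-independent : fromℕ n ≈ 0# → LinearlyIndependent ((halfColumn ∘ P) ᵀ) →
                       LinearlyIndependent (Ĥ X ⊡ Ĥ X ᵀ)
    gram-independent n≈0 rows-independent α rel =
      -- Independence of the columns gives g = 0. As `g` is the combination of rows with
      -- coefficients `α`, independence of the rows then gives α = 0.
      rows-independent α (halfColumns-independent g g-relation)
      where
      a : Fin D → Fin n → Carrier
      a j i = halfColumn (P i) j

      g : Fin n → Carrier
      g i = ∑[ j < D ] (α j * a j i)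

      -- Component `j` of the relation is a sum over the points of `X` of the functional `f` times
      -- row `j` of `Ĥ`; at the midpoint of P i and P k both factors split into endpoint terms.
      pairs≈0 : ∀ j → ∑ₗ (orderedPairs n) (uncurry (λ i k → (g i + g k) * (a j i + a j k))) ≈ 0#
      pairs≈0 j = begin
        ∑ₗ (orderedPairs n) (uncurry (λ i k → (g i + g k) * (a j i + a j k)))
          ≈⟨ ∑ₗ-cong-All (All.map (λ i<k → sym (*-cong (f-mid (Fin.<⇒≢ i<k)) (ĥ-mid (Fin.<⇒≢ i<k) j)))
                                  (orderedPairs-< n)) ⟩
        ∑ₗ (orderedPairs n) (λ ik → f (uncurry mid ik) * ĥ (uncurry mid ik) j)
          ≡⟨ ≡.sym (∑ₗ-map (uncurry mid) (orderedPairs n) (λ x → f x * ĥ x j)) ⟩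
        ∑ₗ (map (uncurry mid) (orderedPairs n)) (λ x → f x * ĥ x j)
          ≡⟨ ≡.cong (λ xs → ∑ₗ xs (λ x → f x * ĥ x j)) (≡.sym points-X) ⟩
        ∑ₗ (FiniteSet.points X) (λ x → f x * ĥ x j)
          ≈⟨ sum-cong-≋ (λ l → *-cong (sum-cong-≋ (λ i → *-congˡ {α i} (sym (Ĥ-column i l))))
                                      (sym (Ĥ-column j l))) ⟩
        ∑[ l < ∣ X ∣ ] (∑[ i < D ] (α i * Ĥ X i l) * Ĥ X j l)
          ≈⟨ sym (∑-assoc α (Ĥ X) (Ĥ X j)) ⟩
        ∑[ i < D ] (α i * (Ĥ X ⊡ Ĥ X ᵀ) i j)
          ≈⟨ rel j ⟩
        0# ∎
        where
        f : Point d → Carrier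
        f x = ∑[ i < D ] (α i * ĥ x i)
        f-mid : ∀ {i k} → i ≢ k → f (mid i k) ≈ g i + g k
        f-mid {i} {k} i≢k = trans
          (sum-cong-≋ (λ j → trans (*-congˡ {α j} (ĥ-mid i≢k j)) (distribˡ (α j) (a j i) (a j k))))
          (∑-distrib-+ (λ j → α j * a j i) (λ j → α j * a j k))

      -- The constant row must come first: its own sum is n · ½ = 0, so `pairing≈0` applies before
      -- anything is known about `sum g`. For the other rows, `sum g` being zero then supplies the
      -- hypothesis.
      ∑g≈0 : sum g ≈ 0#
      ∑g≈0 = x*y≈0⇒y≈0 ½≉0 (trans (*-comm ½ (sum g)) (trans (*-distribʳ-sum ½ g)
        (pairing≈0 n≈0 g (a (suc zero)) (trans (*-congˡ (∑-const {n} n≈0 ½)) (zeroʳ (sum g)))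
                   (pairs≈0 (suc zero)))))

      g-relation : ∀ j → ∑[ i < n ] (g i * a j i) ≈ 0#
      g-relation j = pairing≈0 n≈0 g (a j) (trans (*-congʳ ∑g≈0) (zeroˡ _)) (pairs≈0 j)

  -- Ranks deduced from a nonsingular Gram matrix.

  module NondegenerateGram {d} (S : FiniteSet d) (gram : LinearlyIndependent (Ĥ S ⊡ Ĥ S ᵀ)) where

    -- A relation among the rows of `Ĥ S`, multiplied on the right by the transpose, becomes one
    -- among the rows of the Gram matrix.
    Ĥ-independent : LinearlyIndependent (Ĥ S)
    Ĥ-independent α rel = gram α λ j → begin
      ∑[ i < 2 ℕ.+ d ] (α i * (Ĥ S ⊡ Ĥ S ᵀ) i j)
        ≈⟨ ∑-assoc α (Ĥ S) (Ĥ S j) ⟩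
      ∑[ l < ∣ S ∣ ] (∑[ i < 2 ℕ.+ d ] (α i * Ĥ S i l) * Ĥ S j l)
        ≈⟨ ∑-zero (λ l → trans (*-congʳ (rel l)) (zeroˡ (Ĥ S j l))) ⟩
      0# ∎

    -- This matrix is the Gram matrix without its top row, the one belonging to Q; a relation
    -- extends by the coefficient 0 there.
    HĤᵀ-independent : LinearlyIndependent (H S ⊡ Ĥ S ᵀ)
    HĤᵀ-independent α rel i = gram (0# VF.∷ α)
      (λ j → trans (+-cong (zeroˡ ((Ĥ S ⊡ Ĥ S ᵀ) zero j)) (rel j)) (+-identityˡ 0#)) (suc i)

    rank-Ĥ : rank (Ĥ S) ≡ 2 ℕ.+ d
    rank-Ĥ = rank-full (Ĥ S) Ĥ-independent

    rank-HĤᵀ : rank (H S ⊡ Ĥ S ᵀ) ≡ 1 ℕ.+ d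
    rank-HĤᵀ = rank-full (H S ⊡ Ĥ S ᵀ) HĤᵀ-independent

    rank-difference : + rank (Ĥ S) ℤ.- + rank (H S ⊡ Ĥ S ᵀ) ≡ 1ℤ
    rank-difference = difference≡1 rank-Ĥ rank-HĤᵀ

    sharp : ∀ {a b} → IsTwoDistance S a b → ¬ a ≈ 0# → ¬ b ≈ 0# →
            GeneralBound d → + ∣ S ∣ ℤ.≤ + ((2 ℕ.+ d) C 2)
    sharp two-distance a≉0 b≉0 generalBound = ≡.subst (+ ∣ S ∣ ℤ.≤_)
      (bound≡binomial rank-Ĥ rank-HĤᵀ)
      (generalBound S _ _ two-distance a≉0 b≉0)

proposition4p7 : ∀ {c ℓ} (q : ℕ) → IsPrimePower q → ¬ (2 ∣ q) →
    (F : FiniteField c ℓ q) →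
    let open FiniteField F
        open LinearAlgebra F
        open Geometry F
    in
    (p : ℕ) → IsCharacteristic p →
    (d : ℕ) → 2 ℕ.≤ d → p ∣ 2 ℕ.+ d →
    (P : Vector (Point d) (2 ℕ.+ d)) (Δ : Carrier) →
    ¬ (Δ ≈ 0#) → IsEquilateral P Δ →
    let X = midpointSet P in
    IsTwoDistance X (Δ / fromℕ 4) (Δ / fromℕ 2)
    × ∣ X ∣ ≡ (2 ℕ.+ d) C 2
    × + rank (Ĥ X) ℤ.- + rank (H X ⊡ Ĥ X ᵀ) ≡ 1ℤ
    × ¬ (Δ / fromℕ 4 ≈ 0#)
    × ¬ (Δ / fromℕ 2 ≈ 0#)
    × bound X ≡ + ((2 ℕ.+ d) C 2)
    × (GeneralBound d → + ∣ X ∣ ℤ.≤ + ((2 ℕ.+ d) C 2))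
proposition4p7 q _ 2∤q F p (_ , p≈0 , _) d 2≤d p∣d+2 P Δ Δ≉0 equilateral =
  two-distance , ∣X∣≡nC2 , rank-difference , Δ/4≉0 , Δ/2≉0 ,
  -- Inferring the matrices from the goal is much faster than comparing two ranks.
  bound≡binomial (rank-full _ Ĥ-independent) (rank-full _ HĤᵀ-independent) ,
  sharp two-distance Δ/4≉0 Δ/2≉0
  where
  open Geometry F using (midpointSet)
  open FieldProperties F using (odd⇒2≉0; fromℕ-∣)
  open LinearAlgebraProperties F using (linearlyIndependent-ᵀ; rank-full)
  open EquilateralSets F (odd⇒2≉0 2∤q)
  open MidpointDistances P Δ Δ≉0 equilateral using (Δ/4≉0; Δ/2≉0; ∣X∣≡nC2)
  open Gram P Δ Δ≉0 equilateral using (halfColumn; halfColumns-independent; gram-independent)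
  open NondegenerateGram (midpointSet P)
    -- The number d + 2 enters twice: it vanishes in the field because `p` divides it, and, being
    -- both the number of vertices and the length of a `halfColumn`, it makes their matrix square,
    -- so that independence passes from columns to rows.
    (gram-independent (fromℕ-∣ p∣d+2 p≈0) (linearlyIndependent-ᵀ (halfColumn ∘ P) halfColumns-independent))
  two-distance = midpointSet-isTwoDistance 2≤d P Δ Δ≉0 equilateral
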